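{- Let $k\geq 3$. Then, as formal (Laurent) series in $x$ with coefficients polynomial in $p$, $$\sum_{n\geq0}\sum_{\pi\in\mathcal{I}_n(\mathcal{A}_k)}x^np^{\mathrm{fix}(\pi)} =\sum_{j=0}^{k-3}J_j(p)x^j-\frac{x^{k-3}}{2}\Bigl(p+\bigl(p(k-3)x^2-2x-p\bigr)u_0(x)\Bigr)J_{k-2}(p) -\frac{x^{k-4}}{2}\Bigl(x+p-\bigl(x^3(k-3)-px^2(k-1)+x+p\bigr)u_0(x)\Bigr)J_{k-3}(p),$$ where $u_0(x)=1/\sqrt{1-2(k-1)x^2+(k-3)^2x^4}$ (the power series with constant term $1$).
   Context: Permutations are written in one-line notation; $\mathfrak{S}_n$ is the set of permutations of $[n]=\{1,\dots,n\}$. A permutation $\pi\in\mathfrak{S}_n$ contains a pattern $\tau\in\mathfrak{S}_k$ if there are indices $i_1<\dots<i_k$ with $(\pi_{i_1},\dots,\pi_{i_k})$ order-isomorphic to $\tau$; otherwise $\pi$ avoids $\tau$; $\pi$ avoids a set $T$ of patterns if it avoids every $\tau\in T$. An involution is a permutation with $\pi_{\pi_i}=i$ for all $i$; $\mathcal{I}_n$ is the set of involutions of $[n]$ and $\mathcal{I}_n(T)$ those avoiding $T$ ($\mathcal{I}_0$ consists of the empty permutation). $\mathcal{A}_k=\{\sigma\in\mathfrak{S}_k:\sigma_1=1,\sigma_2=2\}$. $\mathrm{fix}(\pi)$ is the number of $i$ with $\pi_i=i$. $J_n(p)=\sum_{\pi\in\mathcal{I}_n}p^{\mathrm{fix}(\pi)}$;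 equivalently $J_0=1$, $J_1=p$, $J_n(p)=pJ_{n-1}(p)+(n-1)J_{n-2}(p)$ for $n\ge2$. -}

module Defs where

open import Algebra.Bundles.Raw using (RawRing)
open import Data.Fin as Fin using (Fin; toℕ; fromℕ; inject₁)
import Data.Fin.Properties as Fin
open import Data.Integer as ℤ using (ℤ; +_; -[1+_])
open import Data.List using (List; []; _∷_; map; foldr; filter; length; allFin; cartesianProductWith)
open import Data.List.Membership.Propositional using (_∈_; lose)
open import Data.List.Membership.Propositional.Properties using (∈-allFin; ∈-cartesianProductWith⁺)
open import Data.List.Relation.Unary.All using (All) renaming (all? to All?)
open import Data.List.Relation.Unary.Any using (here; satisfied) renaming (any? to Any?)
open import Data.Nat as ℕ using (ℕ; zero; suc; _∸_)
import Data.Nat.Properties as ℕ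
open import Data.Product using (∃; _×_; _,_; proj₁; proj₂)
open import Data.Rational as ℚ using (ℚ; 0ℚ; 1ℚ; ½)
import Data.Rational.Properties as ℚ
open import Data.Vec using (Vec; []; _∷_; lookup)
open import Function using (_⇔_; mk⇔; Equivalence; Bijective)
open import Level using (_⊔_)
open import Relation.Binary.PropositionalEquality using (_≡_; refl; sym; trans; cong; cong₂; module ≡-Reasoning)
open import Relation.Nullary using (¬_; Dec; yes; no; ¬?; contradiction)
open import Relation.Nullary.Decidable using (map′; _×-dec_; _→-dec_)
open import Relation.Unary using (Pred; Decidable)

-- Words in one-line notation.  Positions and values are 0-based: the
-- integers 1, …, n are represented by the elements of Fin n.
Word : ℕ → Set
Word n = Vec (Fin n) n

vectors : ∀ n m → List (Vec (Fin n) m)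
vectors n zero    = [] ∷ []
vectors n (suc m) = cartesianProductWith _∷_ (allFin n) (vectors n m)

∈-vectors : ∀ {n m} (v : Vec (Fin n) m) → v ∈ vectors n m
∈-vectors []      = here refl
∈-vectors (x ∷ v) = ∈-cartesianProductWith⁺ _∷_ (∈-allFin x) (∈-vectors v)

∃-vector? : ∀ {n m p} {P : Pred (Vec (Fin n) m) p} → Decidable P → Dec (∃ P)
∃-vector? P? = map′ satisfied (λ (v , Pv) → lose (∈-vectors v) Pv) (Any? P? (vectors _ _))

IsPermutation : ∀ {n} → Word n → Set
IsPermutation π = Bijective _≡_ _≡_ (lookup π)

isPermutation? : ∀ {n} → Decidable (IsPermutation {n})
isPermutation? π =
  map′ (λ (inj , sur) → (λ {i} {j} → inj i j)
                      , λ y → proj₁ (sur y) , λ z≡x → trans (cong (lookup π) z≡x) (proj₂ (sur y)))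
       (λ (inj , sur) → (λ i j → inj {i} {j})
                      , λ y → proj₁ (sur y) , proj₂ (sur y) refl)
       (Fin.all? (λ i → Fin.all? λ j → (lookup π i Fin.≟ lookup π j) →-dec (i Fin.≟ j))
         ×-dec Fin.all? λ y → Fin.any? λ x → lookup π x Fin.≟ y)

IsInvolution : ∀ {n} → Word n → Set
IsInvolution π = IsPermutation π × (∀ i → lookup π (lookup π i) ≡ i)

isInvolution? : ∀ {n} → Decidable (IsInvolution {n})
isInvolution? π = isPermutation? π ×-dec Fin.all? λ i → lookup π (lookup π i) Fin.≟ i

-- ι lists the positions i₁ < … < iₖ of an occurrence of τ in π.
IsOccurrence : ∀ {k n} → Word k → Word n → Vec (Fin n) k → Set
IsOccurrence τ π ι =
  (∀ a b → a Fin.< b → lookup ι a Fin.< lookup ι b) ×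
  (∀ a b → lookup τ a Fin.< lookup τ b ⇔ lookup π (lookup ι a) Fin.< lookup π (lookup ι b))

isOccurrence? : ∀ {k n} (τ : Word k) (π : Word n) → Decidable (IsOccurrence τ π)
isOccurrence? τ π ι =
  Fin.all? (λ a → Fin.all? λ b → (a Fin.<? b) →-dec (lookup ι a Fin.<? lookup ι b))
  ×-dec Fin.all? λ a → Fin.all? λ b →
    (lookup τ a Fin.<? lookup τ b) ⇔-dec (lookup π (lookup ι a) Fin.<? lookup π (lookup ι b))
  where
  _⇔-dec_ : ∀ {A B : Set} → Dec A → Dec B → Dec (A ⇔ B)
  A? ⇔-dec B? = map′ (λ (f , g) → mk⇔ f g) (λ e → Equivalence.to e , Equivalence.from e)
                     ((A? →-dec B?) ×-dec (B? →-dec A?))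

Contains : ∀ {k n} → Word n → Word k → Set
Contains π τ = ∃ (IsOccurrence τ π)

Avoids : ∀ {k n} → List (Word k) → Word n → Set
Avoids T π = All (λ τ → ¬ Contains π τ) T

avoids? : ∀ {k n} (T : List (Word k)) → Decidable (Avoids {n = n} T)
avoids? T π = All? (λ τ → ¬? (∃-vector? (isOccurrence? τ π))) T

𝔖 : ∀ n → List (Word n)
𝔖 n = filter isPermutation? (vectors n n)

ℐ : ∀ n → List (Word n)
ℐ n = filter isInvolution? (vectors n n)

ℐ-avoiding : ∀ {k} → List (Word k) → ∀ n → List (Word n)
ℐ-avoiding T n = filter (avoids? T) (ℐ n)

-- For k ≥ 2: σ₁ = 1 and σ₂ = 2, in 0-based form.
𝒜 : ∀ k → List (Word k)
𝒜 k = filter (λ σ → Fin.all? λ i → (toℕ i ℕ.<? 2) →-dec (lookup σ i Fin.≟ i)) (𝔖 k)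

fix : ∀ {n} → Word n → ℕ
fix π = length (filter (λ i → lookup π i Fin.≟ i) (allFin _))

module Polynomial {c ℓ} (R : RawRing c ℓ) where
  open RawRing R

  -- Coefficient lists, constant term first; trailing zeros are allowed,
  -- so equality is coefficientwise.
  Poly : Set c
  Poly = List Carrier

  coeff : Poly → ℕ → Carrier
  coeff []       _       = 0#
  coeff (a ∷ as) zero    = a
  coeff (a ∷ as) (suc i) = coeff as i

  _⊞_ : Poly → Poly → Poly
  []       ⊞ bs       = bs
  (a ∷ as) ⊞ []       = a ∷ as
  (a ∷ as) ⊞ (b ∷ bs) = a + b ∷ as ⊞ bs

  _⊠_ : Poly → Poly → Poly
  []       ⊠ bs = []
  (a ∷ as) ⊠ bs = map (a *_) bs ⊞ (0# ∷ as ⊠ bs)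

  constant : Carrier → Poly
  constant a = a ∷ []

  indeterminate : Poly
  indeterminate = 0# ∷ 1# ∷ []

  rawRing : RawRing c ℓ
  rawRing = record
    { Carrier = Poly
    ; _≈_     = λ as bs → ∀ i → coeff as i ≈ coeff bs i
    ; _+_     = _⊞_
    ; _*_     = _⊠_
    ; -_      = map (-_)
    ; 0#      = []
    ; 1#      = constant 1#
    }

module PowerSeries {c ℓ} (R : RawRing c ℓ) where
  open RawRing R
  open import Algebra.Definitions.RawSemiring rawSemiring using (sum)

  Series : Set c
  Series = ℕ → Carrier

  infixl 7 _⊛_
  _⊛_ : Series → Series → Series
  (a ⊛ b) n = sum {suc n} λ i → a (toℕ i) * b (n ∸ toℕ i)

  monomial : ℕ → Carrier → Series
  monomial zero    c zero    = c
  monomial zero    c (suc n) = 0#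
  monomial (suc m) c zero    = 0#
  monomial (suc m) c (suc n) = monomial m c n

  -- Multiplication by the m-th power of the variable.
  shift : ℕ → Series → Series
  shift zero    a n       = a n
  shift (suc m) a zero    = 0#
  shift (suc m) a (suc n) = shift m a n

module LaurentSeries {c ℓ} (R : RawRing c ℓ) where
  open RawRing R
  open PowerSeries R

  -- x⁻ d · a represents ∑ₙ aₙ xⁿ⁻ᵈ.  The representation is not unique;
  -- equality compares the coefficient of xᶻ for every integer z.
  infix 5 x⁻_·_
  record Laurent : Set c where
    constructor x⁻_·_
    field
      pole      : ℕ
      numerator : Series

  coeff : Laurent → ℤ → Carrier
  coeff (x⁻ d · a) z = at (z ℤ.+ + d)
    where
    at : ℤ → Carrier
    at (+ n)    = a n
    at -[1+ _ ] = 0#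

  fromSeries : Series → Laurent
  fromSeries a = x⁻ 0 · a

  constant : Carrier → Laurent
  constant c = fromSeries (monomial 0 c)

  infix 9 x^_
  x^_ : ℤ → Laurent
  x^ (+ n)    = x⁻ 0 · monomial n 1#
  x^ -[1+ n ] = x⁻ suc n · monomial 0 1#

  rawRing : RawRing c ℓ
  rawRing = record
    { Carrier = Laurent
    ; _≈_     = λ f g → ∀ z → coeff f z ≈ coeff g z
    ; _+_     = λ (x⁻ d · a) (x⁻ e · b) → x⁻ d ℕ.+ e · λ n → shift e a n + shift d b n
    ; _*_     = λ (x⁻ d · a) (x⁻ e · b) → x⁻ d ℕ.+ e · a ⊛ b
    ; -_      = λ (x⁻ d · a) → x⁻ d · λ n → - a n
    ; 0#      = constant 0#
    ; 1#      = constant 1#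
    }

module _ where
  open PowerSeries ℚ.+-*-rawRing
  open import Algebra.Properties.Monoid.Sum ℚ.+-0-monoid using (sum; sum-init-last; sum-cong-≗)
  open import Data.Rational.Solver using (module +-*-Solver)
  open +-*-Solver using (solve; _:+_; _:*_; _:=_; con)
  open ≡-Reasoning

  -- For a with constant term 1, the coefficients of the series u with
  -- u₀ = 1 and u² a = 1.  For n ≥ 1 the coefficient of xⁿ in u² a is
  -- 2 uₙ + [xⁿ] (v² a), where v is u truncated to degrees below n.
  module _ (a : Series) where
    next : ℕ → Series → ℚ
    next zero    v = 1ℚ
    next (suc n) v = ℚ.- (½ ℚ.* (v ⊛ v ⊛ a) (suc n))

    truncated : ℕ → Series
    truncated zero    m = 0ℚ
    truncated (suc n) m with m ℕ.≟ n
    ... | yes _ = next n (truncated n)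
    ... | no  _ = truncated n m

    1/√_ : Series
    1/√_ n = next n (truncated n)

    truncated-< : ∀ {m} n → m ℕ.< n → truncated n m ≡ 1/√_ m
    truncated-< {m} (suc n) m<1+n with m ℕ.≟ n
    ... | yes refl = refl
    ... | no  m≢n  = truncated-< n (ℕ.≤∧≢⇒< (ℕ.s≤s⁻¹ m<1+n) m≢n)

    truncated-≥ : ∀ {m} n → n ℕ.≤ m → truncated n m ≡ 0ℚ
    truncated-≥ {m} zero    _   = refl
    truncated-≥ {m} (suc n) n<m with m ℕ.≟ n
    ... | yes refl = contradiction n<m (ℕ.<-irrefl refl)
    ... | no  _    = truncated-≥ n (ℕ.<⇒≤ n<m)

  1/√-constant : ∀ a → (1/√ a) 0 ≡ 1ℚ
  1/√-constant a = refl

  ⊛-cong : ∀ {a a′ b b′} n → (∀ m → m ℕ.≤ n → a m ≡ a′ m) → (∀ m → m ℕ.≤ n → b m ≡ b′ m) →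
           (a ⊛ b) n ≡ (a′ ⊛ b′) n
  ⊛-cong n a≡ b≡ = sum-cong-≗ {suc n} λ i →
    cong₂ ℚ._*_ (a≡ (toℕ i) (Fin.toℕ≤pred[n] i)) (b≡ (n ∸ toℕ i) (ℕ.m∸n≤m n (toℕ i)))

  ⊛-last : ∀ a b n → (a ⊛ b) n ≡ sum {n} (λ i → a (toℕ i) ℚ.* b (n ∸ toℕ i)) ℚ.+ a n ℚ.* b 0
  ⊛-last a b n = begin
    (a ⊛ b) n
      ≡⟨ sum-init-last {n} (λ i → a (toℕ i) ℚ.* b (n ∸ toℕ i)) ⟩
    sum {n} (λ i → a (toℕ (inject₁ i)) ℚ.* b (n ∸ toℕ (inject₁ i)))
      ℚ.+ a (toℕ (fromℕ n)) ℚ.* b (n ∸ toℕ (fromℕ n))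
      ≡⟨ cong₂ ℚ._+_
           (sum-cong-≗ {n} λ i → cong (λ m → a m ℚ.* b (n ∸ m)) (Fin.toℕ-inject₁ i))
           (trans (cong (λ m → a m ℚ.* b (n ∸ m)) (Fin.toℕ-fromℕ n))
                  (cong (λ m → a n ℚ.* b m) (ℕ.n∸n≡0 n))) ⟩
    sum {n} (λ i → a (toℕ i) ℚ.* b (n ∸ toℕ i)) ℚ.+ a n ℚ.* b 0 ∎

  1/√-correct : ∀ a → a 0 ≡ 1ℚ → ∀ n → (1/√ a ⊛ 1/√ a ⊛ a) n ≡ monomial 0 1ℚ n
  1/√-correct a a₀≡1 zero rewrite a₀≡1 = refl
  1/√-correct a a₀≡1 (suc n) = begin
    (u ⊛ u ⊛ a) N
      ≡⟨ ⊛-last (u ⊛ u) a N ⟩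
    sum {N} (λ i → (u ⊛ u) (toℕ i) ℚ.* a (N ∸ toℕ i)) ℚ.+ (u ⊛ u) N ℚ.* a 0
      ≡⟨ cong₂ ℚ._+_
           (sum-cong-≗ {N} λ i → cong (ℚ._* a (N ∸ toℕ i)) (low (toℕ i) (Fin.toℕ<n i)))
           (cong₂ ℚ._*_ top a₀≡1) ⟩
    S ℚ.+ (u N ℚ.+ (V ℚ.+ u N)) ℚ.* 1ℚ
      ≡⟨ solve 3 (λ s w h → s :+ (w :+ (h :+ w)) :* con 1ℚ
                         := s :+ h :* con 1ℚ :+ con (1ℚ ℚ.+ 1ℚ) :* w) refl S (u N) V ⟩
    S ℚ.+ V ℚ.* 1ℚ ℚ.+ (1ℚ ℚ.+ 1ℚ) ℚ.* u N
      ≡⟨ cong (λ z → z ℚ.+ (1ℚ ℚ.+ 1ℚ) ℚ.* u N)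
           (sym (trans (⊛-last (v ⊛ v) a N) (cong₂ (λ s t → S ℚ.+ s ℚ.* t) vv-top a₀≡1))) ⟩
    W ℚ.+ (1ℚ ℚ.+ 1ℚ) ℚ.* (ℚ.- (½ ℚ.* W))
      ≡⟨ cong (W ℚ.+_) (trans (sym (ℚ.neg-distribʳ-* (1ℚ ℚ.+ 1ℚ) (½ ℚ.* W)))
           (cong ℚ.-_ (trans (sym (ℚ.*-assoc (1ℚ ℚ.+ 1ℚ) ½ W)) (ℚ.*-identityˡ W)))) ⟩
    W ℚ.- W
      ≡⟨ ℚ.+-inverseʳ W ⟩
    0ℚ ∎
    where
    N = suc n
    u = 1/√ a
    v = truncated a N
    W = (v ⊛ v ⊛ a) N
    S = sum {N} (λ i → (v ⊛ v) (toℕ i) ℚ.* a (N ∸ toℕ i))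
    V = sum {n} (λ i → v (suc (toℕ i)) ℚ.* v (n ∸ toℕ i))

    u≡v : ∀ m → m ℕ.< N → u m ≡ v m
    u≡v m m<N = sym (truncated-< a N m<N)

    low : ∀ m → m ℕ.< N → (u ⊛ u) m ≡ (v ⊛ v) m
    low m m<N = ⊛-cong m eq eq
      where
      eq : ∀ i → i ℕ.≤ m → u i ≡ v i
      eq i i≤m = u≡v i (ℕ.≤-<-trans i≤m m<N)

    vN : v N ≡ 0ℚ
    vN = truncated-≥ a N ℕ.≤-refl

    v0 : v 0 ≡ 1ℚ
    v0 = sym (u≡v 0 ℕ.z<s)

    split : ∀ b → (b ⊛ b) N ≡
      b 0 ℚ.* b N ℚ.+ (sum {n} (λ i → b (suc (toℕ i)) ℚ.* b (n ∸ toℕ i)) ℚ.+ b N ℚ.* b 0)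
    split b = cong (b 0 ℚ.* b N ℚ.+_) (⊛-last (λ m → b (suc m)) b n)

    top : (u ⊛ u) N ≡ u N ℚ.+ (V ℚ.+ u N)
    top = trans (split u) (cong₂ ℚ._+_ (ℚ.*-identityˡ (u N)) (cong₂ ℚ._+_
      (sum-cong-≗ {n} λ i → cong₂ ℚ._*_ (u≡v (suc (toℕ i)) (ℕ.s<s (Fin.toℕ<n i)))
                                        (u≡v (n ∸ toℕ i) (ℕ.s≤s (ℕ.m∸n≤m n (toℕ i)))))
      (ℚ.*-identityʳ (u N))))

    vv-top : (v ⊛ v) N ≡ V
    vv-top = begin
      (v ⊛ v) N
        ≡⟨ split v ⟩
      v 0 ℚ.* v N ℚ.+ (V ℚ.+ v N ℚ.* v 0)
        ≡⟨ cong₂ (λ s t → s ℚ.* t ℚ.+ (V ℚ.+ t ℚ.* s)) v0 vN ⟩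
      1ℚ ℚ.* 0ℚ ℚ.+ (V ℚ.+ 0ℚ ℚ.* 1ℚ)
        ≡⟨ trans (ℚ.+-identityˡ _) (ℚ.+-identityʳ V) ⟩
      V ∎

module ℚ[p] where
  open Polynomial ℚ.+-*-rawRing public
  open RawRing rawRing public hiding (rawSemiring)
  open import Algebra.Definitions.RawSemiring (RawRing.rawSemiring rawRing) public using (_^_)

fixSum : ∀ {n} → List (Word n) → ℚ[p].Poly
fixSum πs = foldr ℚ[p]._+_ ℚ[p].0# (map (λ π → ℚ[p].indeterminate ℚ[p].^ fix π) πs)

module 𝕃 = LaurentSeries ℚ[p].rawRing

open RawRing 𝕃.rawRing public using (_≈_; _+_; _*_; -_)
open import Algebra.Definitions.RawSemiring (RawRing.rawSemiring 𝕃.rawRing) public using (sum)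
open 𝕃 public using (Laurent; x^_)

infixl 6 _-_
_-_ : Laurent → Laurent → Laurent
f - g = f + (- g)

scalar : ℚ → Laurent
scalar q = 𝕃.constant (ℚ[p].constant q)

int : ℤ → Laurent
int z = scalar (z ℚ./ 1)

x p : Laurent
x = x^ (+ 1)
p = 𝕃.constant ℚ[p].indeterminate

J : ℕ → Laurent
J n = 𝕃.constant (fixSum (ℐ n))

involutionSeries : ∀ {k} → List (Word k) → Laurent
involutionSeries T = 𝕃.fromSeries λ n → fixSum (ℐ-avoiding T n)

discriminant : ℕ → ℕ → ℚ
discriminant k 0 = 1ℚ
discriminant k 2 = (ℤ.- (+ 2 ℤ.* (k ℤ.⊖ 1))) ℚ./ 1
discriminant k 4 = ((k ℤ.⊖ 3) ℤ.* (k ℤ.⊖ 3)) ℚ./ 1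
discriminant k _ = 0ℚ

u₀ : ℕ → Laurent
u₀ k = 𝕃.fromSeries λ n → ℚ[p].constant ((1/√ discriminant k) n)

{-# OPTIONS --safe #-}
module Submission where

-- Write m = k − 3 and call a point of an involution heavy if more than m points lie to its
-- north-east.  An involution avoids 𝒜 k exactly when each point with another point to its
-- south-west is light.  Involutions are generated by inserting the cycle of the first letter,
-- which leaves the north-east counts of the old points unchanged.  The admissible insertions
-- depend only on the size n and on the number s of positions after the last heavy one (s = n
-- if all points are light): a fixed point may be inserted iff s = n, and a two-cycle with
-- t ≤ n points above it iff t ≤ s; the new points are heavy iff t > m.  The generating function
-- of the subtree below a node therefore satisfies a linear recurrence in s, which is solved by
-- geometric progressions whose ratio is a root of the kernel, a quadratic with discriminant
-- 1 − 2 (k − 1) x² + (k − 3)² x⁴.  All words with at most m + 1 letters have only light points,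
-- which is where the involution polynomials J come in.

import Defs
open import Defs
  using (1/√_; 1/√-correct; Avoids; Contains; IsInvolution; IsPermutation; Laurent; Word; avoids?;
         discriminant; fix; fixSum; involutionSeries; isInvolution?; isPermutation?;
         module PowerSeries; module ℚ[p]; module 𝕃; vectors; ℐ; ℐ-avoiding; ∈-vectors; 𝒜; 𝔖)
open import Algebra.Bundles using (CommutativeRing)
open import Algebra.Bundles.Raw using (RawRing)
open import Algebra.Solver.Ring.AlmostCommutativeRing using (_-Raw-AlmostCommutative⟶_; fromCommutativeRing; -raw-almostCommutative⟶)
open import Data.Fin using (Fin; toℕ)
open import Data.Integer using (+_; -[1+_])
open import Data.List using (List)
open import Data.Nat as ℕ using (ℕ; zero; suc)
import Data.Rational as ℚ
import Data.Rational.Properties as ℚ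
open import Function using (_⇔_)
open import Level using (0ℓ) renaming (suc to lsuc)
open import Relation.Binary.PropositionalEquality as ≡ using (_≡_)

-- The tree is never summed directly. Candidate closed forms for the subtrees are posited
-- (`descendants`) and checked against one insertion step (`weight-kernel`); the resulting relation
-- `tailGF n ≈ avoidingGF (suc n) + x * tailGF (suc n)` then determines every coefficient. An
-- insertion adds one or two letters, so cutting the tree at a length meets two families of
-- subtrees: those rooted at that length and those entered by a two-cycle that jumps over it. They
-- produce the terms with `J (k ∸ 2)` and `J (k ∸ 3)`. With y = x², a word with heavy points and
-- state s has subtree H(s) = 1 + y ((m + 1) H(s + 1) + ∑ H(t)), the sum over m < t ≤ s,
-- independently of n. Differencing in s gives the kernel (m + 1) y lam² - (1 + m y) lam + 1 = 0 for
-- the ratio; `lam` is its power series root, and `μ` = H(m) = (m + 1) lam - m. The algebra uses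
-- only the polynomial relations in `Roots`, so no square root and no division by x enters it. For k
-- = 3 the formula contains x⁻¹, and the two sides are compared after multiplication by x.

-- The commutative ring of formal power series

module PowerSeriesRing {c ℓ} (R : CommutativeRing c ℓ) where
  open import Data.Nat using (_∸_)
  open import Data.Product using (_,_)
  open CommutativeRing R
  open PowerSeries rawRing public
  open import Algebra.Properties.CommutativeMonoid.Sum +-commutativeMonoid
    using (sum-cong-≋)
  open import Algebra.Properties.Ring ring using (-0#≈0#)
  open import Algebra.Solver.CommutativeMonoid +-commutativeMonoid using (solve; _⊕_; _⊜_; id)
  open import Relation.Binary.Reasoning.Setoid setoid

  infix 4 _≋_
  _≋_ : Series → Series → Set ℓ
  a ≋ b = ∀ n → a n ≈ b n

  infixl 6 _⊕′_
  _⊕′_ : Series → Series → Series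
  (a ⊕′ b) n = a n + b n

  -- `(a ⊛ b) (suc n)` unfolds by computation to `a 0 * b (suc n) + (tail a ⊛ b) n`, so the ring
  -- laws go by induction on the degree with `a` replaced by its tail.
  tail : Series → Series
  tail a n = a (suc n)

  interchange : ∀ a b c d → (a + b) + (c + d) ≈ (a + c) + (b + d)
  interchange = solve 4 (λ a b c d → (a ⊕ b) ⊕ (c ⊕ d) ⊜ (a ⊕ c) ⊕ (b ⊕ d)) refl

  ⊛-cong : ∀ {a a′ b b′} → a ≋ a′ → b ≋ b′ → a ⊛ b ≋ a′ ⊛ b′
  ⊛-cong p q n = sum-cong-≋ {suc n} λ i → *-cong (p (toℕ i)) (q (n ∸ toℕ i))

  ⊛-distribʳ : ∀ c a b → (a ⊕′ b) ⊛ c ≋ (a ⊛ c) ⊕′ (b ⊛ c)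
  ⊛-distribʳ c a b zero = begin
    (a 0 + b 0) * c 0 + 0#                   ≈⟨ +-congʳ (distribʳ _ _ _) ⟩
    (a 0 * c 0 + b 0 * c 0) + 0#             ≈⟨ +-congˡ (+-identityˡ 0#) ⟨
    (a 0 * c 0 + b 0 * c 0) + (0# + 0#)      ≈⟨ interchange _ _ _ _ ⟩
    (a 0 * c 0 + 0#) + (b 0 * c 0 + 0#)      ∎
  ⊛-distribʳ c a b (suc n) = begin
    (a 0 + b 0) * c (suc n) + ((tail a ⊕′ tail b) ⊛ c) n
      ≈⟨ +-cong (distribʳ _ _ _) (⊛-distribʳ c (tail a) (tail b) n) ⟩
    (a 0 * c (suc n) + b 0 * c (suc n)) + ((tail a ⊛ c) n + (tail b ⊛ c) n)
      ≈⟨ interchange _ _ _ _ ⟩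
    (a ⊛ c) (suc n) + (b ⊛ c) (suc n) ∎

  ⊛-scale : ∀ k a b → (λ n → k * a n) ⊛ b ≋ λ n → k * (a ⊛ b) n
  ⊛-scale k a b zero = begin
    k * a 0 * b 0 + 0#       ≈⟨ +-cong (*-assoc _ _ _) (sym (zeroʳ k)) ⟩
    k * (a 0 * b 0) + k * 0# ≈⟨ distribˡ _ _ _ ⟨
    k * (a 0 * b 0 + 0#)     ∎
  ⊛-scale k a b (suc n) = begin
    k * a 0 * b (suc n) + ((λ i → k * tail a i) ⊛ b) n
      ≈⟨ +-cong (*-assoc _ _ _) (⊛-scale k (tail a) b n) ⟩
    k * (a 0 * b (suc n)) + k * (tail a ⊛ b) n ≈⟨ distribˡ _ _ _ ⟨
    k * (a ⊛ b) (suc n) ∎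

  ⊛-assoc : ∀ a b c → (a ⊛ b) ⊛ c ≋ a ⊛ (b ⊛ c)
  ⊛-assoc a b c zero = +-congʳ (begin
    (a 0 * b 0 + 0#) * c 0 ≈⟨ *-congʳ (+-identityʳ _) ⟩
    a 0 * b 0 * c 0        ≈⟨ *-assoc _ _ _ ⟩
    a 0 * (b 0 * c 0)      ≈⟨ *-congˡ (+-identityʳ _) ⟨
    a 0 * (b 0 * c 0 + 0#) ∎)
  ⊛-assoc a b c (suc n) = begin
    (a ⊛ b) 0 * c (suc n) + (((λ i → a 0 * tail b i) ⊕′ (tail a ⊛ b)) ⊛ c) n
      ≈⟨ +-cong (*-congʳ (+-identityʳ _)) (⊛-distribʳ c (λ i → a 0 * tail b i) (tail a ⊛ b) n) ⟩
    a 0 * b 0 * c (suc n) + (((λ i → a 0 * tail b i) ⊛ c) n + ((tail a ⊛ b) ⊛ c) n)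
      ≈⟨ +-assoc _ _ _ ⟨
    (a 0 * b 0 * c (suc n) + ((λ i → a 0 * tail b i) ⊛ c) n) + ((tail a ⊛ b) ⊛ c) n
      ≈⟨ +-cong (+-cong (*-assoc _ _ _) (⊛-scale (a 0) (tail b) c n)) (⊛-assoc (tail a) b c n) ⟩
    (a 0 * (b 0 * c (suc n)) + a 0 * (tail b ⊛ c) n) + (tail a ⊛ (b ⊛ c)) n
      ≈⟨ +-congʳ (distribˡ _ _ _) ⟨
    (a ⊛ (b ⊛ c)) (suc n) ∎

  -- Peels the last summand, where the definition peels the first; commutativity matches the two
  -- ends.
  ⊛-unfoldʳ : ∀ a b n → (a ⊛ b) (suc n) ≈ a (suc n) * b 0 + (a ⊛ tail b) n
  ⊛-unfoldʳ a b zero =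
    solve 2 (λ s t → s ⊕ (t ⊕ id) ⊜ t ⊕ (s ⊕ id)) refl (a 0 * b 1) (a 1 * b 0)
  ⊛-unfoldʳ a b (suc n) = begin
    a 0 * b (suc (suc n)) + (tail a ⊛ b) (suc n) ≈⟨ +-congˡ (⊛-unfoldʳ (tail a) b n) ⟩
    a 0 * b (suc (suc n)) + (a (suc (suc n)) * b 0 + (tail a ⊛ tail b) n)
      ≈⟨ solve 3 (λ r s t → r ⊕ (s ⊕ t) ⊜ s ⊕ (r ⊕ t)) refl _ _ _ ⟩
    a (suc (suc n)) * b 0 + (a ⊛ tail b) (suc n) ∎

  ⊛-comm : ∀ a b → a ⊛ b ≋ b ⊛ a
  ⊛-comm a b zero    = +-congʳ (*-comm _ _)
  ⊛-comm a b (suc n) = begin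
    a 0 * b (suc n) + (tail a ⊛ b) n ≈⟨ +-cong (*-comm _ _) (⊛-comm (tail a) b n) ⟩
    b (suc n) * a 0 + (b ⊛ tail a) n ≈⟨ ⊛-unfoldʳ b a n ⟨
    (b ⊛ a) (suc n)                  ∎

  C : Carrier → Series
  C = monomial 0

  X : Series
  X = monomial 1 1#

  zero-⊛ : ∀ {a} → (∀ n → a n ≈ 0#) → ∀ b n → (a ⊛ b) n ≈ 0#
  zero-⊛ a≈0 b zero    = trans (+-identityʳ _) (trans (*-congʳ (a≈0 0)) (zeroˡ _))
  zero-⊛ a≈0 b (suc n) =
    trans (+-cong (trans (*-congʳ (a≈0 0)) (zeroˡ _)) (zero-⊛ (λ i → a≈0 (suc i)) b n)) (+-identityˡ 0#)

  C-⊛ : ∀ k a → C k ⊛ a ≋ λ n → k * a n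
  C-⊛ k a zero    = +-identityʳ _
  C-⊛ k a (suc n) = trans (+-congˡ (zero-⊛ (λ _ → refl) a n)) (+-identityʳ _)

  shift-⊛ : ∀ d a → monomial d 1# ⊛ a ≋ shift d a
  shift-⊛ zero    a n       = trans (C-⊛ 1# a n) (*-identityˡ _)
  shift-⊛ (suc d) a zero    = trans (+-identityʳ _) (zeroˡ _)
  shift-⊛ (suc d) a (suc n) = trans (+-cong (zeroˡ _) (shift-⊛ d a n)) (+-identityˡ _)

  X-⊛-zero : ∀ a → (X ⊛ a) 0 ≈ 0#
  X-⊛-zero a = shift-⊛ 1 a 0

  X-⊛-suc : ∀ a n → (X ⊛ a) (suc n) ≈ a n
  X-⊛-suc a n = shift-⊛ 1 a (suc n)

  X-cancel : ∀ {a b} → X ⊛ a ≋ X ⊛ b → a ≋ b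
  X-cancel {a} {b} eq n = trans (sym (X-⊛-suc a n)) (trans (eq (suc n)) (X-⊛-suc b n))

  ⊛-identityˡ : ∀ a → C 1# ⊛ a ≋ a
  ⊛-identityˡ = shift-⊛ 0

  ⊛-distribˡ : ∀ a b c → a ⊛ (b ⊕′ c) ≋ (a ⊛ b) ⊕′ (a ⊛ c)
  ⊛-distribˡ a b c n = begin
    (a ⊛ (b ⊕′ c)) n        ≈⟨ ⊛-comm a (b ⊕′ c) n ⟩
    ((b ⊕′ c) ⊛ a) n        ≈⟨ ⊛-distribʳ a b c n ⟩
    (b ⊛ a) n + (c ⊛ a) n   ≈⟨ +-cong (⊛-comm b a n) (⊛-comm c a n) ⟩
    (a ⊛ b) n + (a ⊛ c) n   ∎

  commutativeRing : CommutativeRing c ℓ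
  commutativeRing = record
    { Carrier = Series
    ; _≈_ = _≋_
    ; _+_ = _⊕′_
    ; _*_ = _⊛_
    ; -_ = λ a n → - a n
    ; 0# = λ _ → 0#
    ; 1# = C 1#
    ; isCommutativeRing = record
      { isRing = record
        { +-isAbelianGroup = record
          { isGroup = record
            { isMonoid = record
              { isSemigroup = record
                { isMagma = record
                  { isEquivalence = record
                    { refl = λ _ → refl
                    ; sym = λ p n → sym (p n)
                    ; trans = λ p q n → trans (p n) (q n)
                    }
                  ; ∙-cong = λ p q n → +-cong (p n) (q n)
                  }
                ; assoc = λ _ _ _ _ → +-assoc _ _ _
                }
              ; identity = (λ _ _ → +-identityˡ _) , (λ _ _ → +-identityʳ _)
              }
            ; inverse = (λ _ _ → -‿inverseˡ _) , (λ _ _ → -‿inverseʳ _)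
            ; ⁻¹-cong = λ p n → -‿cong (p n)
            }
          ; comm = λ _ _ _ → +-comm _ _
          }
        ; *-cong = ⊛-cong
        ; *-assoc = ⊛-assoc
        ; *-identity = ⊛-identityˡ , λ a n → trans (⊛-comm a (C 1#) n) (⊛-identityˡ a n)
        ; distrib = ⊛-distribˡ , ⊛-distribʳ
        }
      ; *-comm = ⊛-comm
      }
    }

  C-+ : ∀ a b → C (a + b) ≋ C a ⊕′ C b
  C-+ a b zero    = refl
  C-+ a b (suc n) = sym (+-identityˡ 0#)

  C-* : ∀ a b → C (a * b) ≋ C a ⊛ C b
  C-* a b zero    = sym (C-⊛ a (C b) 0)
  C-* a b (suc n) = sym (trans (C-⊛ a (C b) (suc n)) (zeroʳ a))

  C-neg : ∀ a → C (- a) ≋ λ n → - C a n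
  C-neg a zero    = refl
  C-neg a (suc n) = sym -0#≈0#

  C-cong : ∀ {a b} → a ≈ b → C a ≋ C b
  C-cong p zero    = p
  C-cong p (suc n) = refl

  C-0 : C 0# ≋ λ _ → 0#
  C-0 zero    = refl
  C-0 (suc n) = refl

-- Convolution under coefficientwise maps

module SeriesMap {a ℓ b ℓ′} (S : RawRing a ℓ) (R : CommutativeRing b ℓ′)
  (h : RawRing.Carrier S → CommutativeRing.Carrier R)
  (h-+ : ∀ s t → CommutativeRing._≈_ R (h (RawRing._+_ S s t)) (CommutativeRing._+_ R (h s) (h t)))
  (h-* : ∀ s t → CommutativeRing._≈_ R (h (RawRing._*_ S s t)) (CommutativeRing._*_ R (h s) (h t)))
  (h-0 : CommutativeRing._≈_ R (h (RawRing.0# S)) (CommutativeRing.0# R)) where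
  open import Data.Nat using (_∸_)
  open import Function using (_∘_)
  open CommutativeRing R
  private
    module S = PowerSeries S
    module R = PowerSeriesRing R
  open import Algebra.Definitions.RawSemiring (RawRing.rawSemiring S) using () renaming (sum to sumˢ)
  open import Algebra.Properties.CommutativeMonoid.Sum +-commutativeMonoid using (sum; sum-cong-≋)

  map-sum : ∀ {n} (f : Fin n → RawRing.Carrier S) → h (sumˢ f) ≈ sum (h ∘ f)
  map-sum {zero}  f = h-0
  map-sum {suc n} f = trans (h-+ _ _) (+-congˡ (map-sum (f ∘ Fin.suc)))

  map-⊛ : ∀ a b n → h ((a S.⊛ b) n) ≈ ((h ∘ a) R.⊛ (h ∘ b)) n
  map-⊛ a b n = trans (map-sum {suc n} (λ i → RawRing._*_ S (a (toℕ i)) (b (n ∸ toℕ i))))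
    (sum-cong-≋ {suc n} λ i → h-* (a (toℕ i)) (b (n ∸ toℕ i)))

-- Initial segments and tails of a series

module Unfolding {c ℓ} (R : CommutativeRing c ℓ) where
  open import Data.Nat using (_+_)
  open import Function using (_∘_)
  private module Coeff = CommutativeRing R
  open PowerSeriesRing R
  open CommutativeRing commutativeRing hiding (_+_)
  open CommutativeRing commutativeRing using () renaming (_+_ to _⊕_)
  open import Relation.Binary.Reasoning.Setoid setoid
  open import Algebra.Properties.CommutativeMonoid.Sum +-commutativeMonoid using (sum; sum-cong-≋)
  open import Algebra.Properties.Semiring.Sum semiring using (*-distribˡ-sum)

  unfold : ∀ a → a ≈ C (a 0) ⊕ X ⊛ tail a
  unfold a zero    = Coeff.sym (Coeff.trans (Coeff.+-congˡ (X-⊛-zero (tail a))) (Coeff.+-identityʳ _))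
  unfold a (suc n) = Coeff.sym (Coeff.trans (Coeff.+-congˡ (X-⊛-suc (tail a) n)) (Coeff.+-identityˡ _))

  monomial-suc : ∀ j → monomial (suc j) Coeff.1# ≈ X ⊛ monomial j Coeff.1#
  monomial-suc j zero    = Coeff.sym (X-⊛-zero (monomial j Coeff.1#))
  monomial-suc j (suc n) = Coeff.sym (X-⊛-suc (monomial j Coeff.1#) n)

  initial : ℕ → Series → Series
  initial q a = sum {q} λ j → C (a (toℕ j)) ⊛ monomial (toℕ j) Coeff.1#

  split-at : ∀ q a → a ≈ initial q a ⊕ monomial q Coeff.1# ⊛ (λ n → a (q + n))
  split-at zero    a = sym (trans (+-identityˡ _) (*-identityˡ a))
  split-at (suc q) a = begin
    a
      ≈⟨ unfold a ⟩
    C (a 0) ⊕ X ⊛ tail a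
      ≈⟨ +-cong (sym (*-identityʳ (C (a 0)))) (trans (*-congˡ {X} (split-at q (tail a))) (distribˡ X (initial q (tail a)) _)) ⟩
    C (a 0) ⊛ 1# ⊕ (X ⊛ initial q (tail a) ⊕ X ⊛ (monomial q Coeff.1# ⊛ rest))
      ≈⟨ sym (+-assoc (C (a 0) ⊛ 1#) (X ⊛ initial q (tail a)) _) ⟩
    (C (a 0) ⊛ 1# ⊕ X ⊛ initial q (tail a)) ⊕ X ⊛ (monomial q Coeff.1# ⊛ rest)
      ≈⟨ +-cong (+-congˡ {C (a 0) ⊛ 1#} (trans (*-distribˡ-sum {q} X _) (sum-cong-≋ {q} λ j → move (a (suc (toℕ j))) (toℕ j))))
           (trans (sym (*-assoc X (monomial q Coeff.1#) rest)) (*-congʳ {rest} (sym (monomial-suc q)))) ⟩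
    initial (suc q) a ⊕ monomial (suc q) Coeff.1# ⊛ rest ∎
    where
    rest : Series
    rest n = a (suc (q + n))
    move : ∀ c j → X ⊛ (C c ⊛ monomial j Coeff.1#) ≈ C c ⊛ monomial (suc j) Coeff.1#
    move c j = trans (sym (*-assoc X (C c) (monomial j Coeff.1#))) (trans (*-congʳ {monomial j Coeff.1#} (*-comm X (C c)))
      (trans (*-assoc (C c) X (monomial j Coeff.1#)) (*-congˡ {C c} (sym (monomial-suc j)))))

  -- A sequence of series satisfying fₙ = tₙ + x fₙ₊₁ consists of the tails of ∑ tₙ xⁿ.
  telescope : ∀ (t : Series) (f : ℕ → Series) → (∀ n → f n ≈ C (t n) ⊕ X ⊛ f (suc n)) → f 0 ≈ t
  telescope t f step zero    = Coeff.trans (step 0 0)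
    (Coeff.trans (Coeff.+-congˡ (X-⊛-zero (f 1))) (Coeff.+-identityʳ (t 0)))
  telescope t f step (suc n) = Coeff.trans (step 0 (suc n))
    (Coeff.trans (Coeff.+-identityˡ _) (Coeff.trans (X-⊛-suc (f 1) n)
      (telescope (tail t) (f ∘ suc) (λ i → step (suc i)) n)))

-- Integers inside the rationals, and a solver with rational constants

module Rationals where
  open import Data.Integer as ℤ using (ℤ)
  import Data.Integer.Properties as ℤ
  open import Data.Nat.Coprimality using (sym; 1-coprimeTo)
  open import Relation.Binary.PropositionalEquality using (_≡_; cong; trans; cong₂) renaming (sym to ≡-sym)
  open import Data.Integer.Solver using (module +-*-Solver)
  open +-*-Solver using (solve; _:+_; _:*_; _:=_; con)

  -- `i / 1` is normalised through a gcd and is stuck for a variable `i`. On this reduced form the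
  -- rational operations compute, and the laws for `_/ 1` are transported from it.
  fromℤ : ℤ → ℚ.ℚ
  fromℤ i = ℚ.mkℚ i 0 (sym (1-coprimeTo ℤ.∣ i ∣))

  /1 : ∀ i → i ℚ./ 1 ≡ fromℤ i
  /1 i = ℚ.↥p/↧p≡p (fromℤ i)

  /1-+ : ∀ i j → (i ℤ.+ j) ℚ./ 1 ≡ i ℚ./ 1 ℚ.+ j ℚ./ 1
  -- Adding fractions with denominator 1 produces the numerator `i * 1 + j * 1`.
  /1-+ i j = trans (cong (ℚ._/ 1) (solve 2 (λ i j → i :+ j := i :* con (+ 1) :+ j :* con (+ 1)) _≡_.refl i j))
    (≡-sym (cong₂ ℚ._+_ (/1 i) (/1 j)))

  /1-* : ∀ i j → (i ℤ.* j) ℚ./ 1 ≡ (i ℚ./ 1) ℚ.* (j ℚ./ 1)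
  /1-* i j = ≡-sym (cong₂ ℚ._*_ (/1 i) (/1 j))

  /1-neg : ∀ i → (ℤ.- i) ℚ./ 1 ≡ ℚ.- (i ℚ./ 1)
  /1-neg i = trans (/1 (ℤ.- i)) (trans (neg i) (≡-sym (cong ℚ.-_ (/1 i))))
    where
    neg : ∀ i → fromℤ (ℤ.- i) ≡ ℚ.- fromℤ i
    neg (+ 0)        = _≡_.refl
    neg (+ suc n)    = _≡_.refl
    neg ℤ.-[1+ n ]   = _≡_.refl

  1/suc : ℕ → ℚ.ℚ
  1/suc n = ℚ.1/ fromℤ (+ suc n)

  suc*1/suc : ∀ n → (+ suc n ℚ./ 1) ℚ.* 1/suc n ≡ ℚ.1ℚ
  suc*1/suc n = trans (cong (ℚ._* 1/suc n) (/1 (+ suc n))) (ℚ.*-inverseʳ (fromℤ (+ suc n)))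

module RationalSolver {a ℓ} (R : CommutativeRing a ℓ)
  (φ : ℚ.+-*-rawRing -Raw-AlmostCommutative⟶ fromCommutativeRing R) where
  open import Data.Maybe using (Maybe; just; nothing)
  open import Relation.Nullary using (yes; no)
  open import Relation.Binary.PropositionalEquality using (cong)
  open CommutativeRing R
  open _-Raw-AlmostCommutative⟶_ φ using (⟦_⟧)

  private
    _≟_ : ∀ a b → Maybe (⟦ a ⟧ ≈ ⟦ b ⟧)
    a ≟ b with a ℚ.≟ b
    ... | yes eq = just (reflexive (cong ⟦_⟧ eq))
    ... | no  _  = nothing

  open import Algebra.Solver.Ring ℚ.+-*-rawRing (fromCommutativeRing R) φ _≟_ public

-- Kernel method: the recurrences and their geometric solutions

module Kernel {a ℓ} (R : CommutativeRing a ℓ)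
  (φ : ℚ.+-*-rawRing -Raw-AlmostCommutative⟶ fromCommutativeRing R) where
  open import Data.Nat using (_≤?_; _∸_)
  open import Relation.Nullary using (yes; no; contradiction)
  import Data.Nat.Properties as ℕ
  open CommutativeRing R
  open RationalSolver R φ
  open import Relation.Binary.Reasoning.Setoid setoid
  open import Algebra.Properties.Semiring.Exp semiring using (_^_) 
  open _-Raw-AlmostCommutative⟶_ φ using (1-homo) renaming (⟦_⟧ to scalar)

  -- The solver reads numerals as images of rationals; hence the unit appears as `𝟏` and meets `1#`
  -- only through `1-homo`.
  𝟏 𝟐 ½ : Carrier
  ½ = scalar ℚ.½
  𝟏 = scalar ℚ.1ℚ
  𝟐 = scalar (ℚ.1ℚ ℚ.+ ℚ.1ℚ)

  private
    :1 :2 :½ : ∀ {n} → Polynomial n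
    :1 = con ℚ.1ℚ
    :2 = con (ℚ.1ℚ ℚ.+ ℚ.1ℚ)
    :½ = con ℚ.½

  nat : ℕ → Carrier
  nat zero    = 0#
  nat (suc n) = 𝟏 + nat n

  Σ≤ : ℕ → (ℕ → Carrier) → Carrier
  Σ≤ zero    h = h 0
  Σ≤ (suc n) h = h (suc n) + Σ≤ n h

  Σ≤-cong : ∀ n {g h} → (∀ t → t ℕ.≤ n → g t ≈ h t) → Σ≤ n g ≈ Σ≤ n h
  Σ≤-cong zero    eq = eq 0 ℕ.z≤n
  Σ≤-cong (suc n) eq = +-cong (eq (suc n) ℕ.≤-refl) (Σ≤-cong n λ t t≤n → eq t (ℕ.m≤n⇒m≤1+n t≤n))

  Σ≤-const : ∀ n a → Σ≤ n (λ _ → a) ≈ nat (suc n) * a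
  Σ≤-const zero    a = sym (trans (*-congʳ (+-identityʳ 𝟏)) (solve 1 (λ a → :1 :* a := a) refl a))
  Σ≤-const (suc n) a = begin
    a + Σ≤ n (λ _ → a)     ≈⟨ +-congˡ (Σ≤-const n a) ⟩
    a + nat (suc n) * a    ≈⟨ solve 2 (λ a k → a :+ k :* a := (:1 :+ k) :* a) refl a (nat (suc n)) ⟩
    nat (suc (suc n)) * a  ∎

  Σ≤-below : ∀ s n {g h} → s ℕ.≤ n → (∀ t → t ℕ.≤ s → h t ≈ g t) →
             (∀ t → s ℕ.< t → h t ≈ 0#) → Σ≤ n h ≈ Σ≤ s g
  Σ≤-below s zero    ℕ.z≤n low high = low 0 ℕ.z≤n
  Σ≤-below s (suc n) s≤1+n low high with s ℕ.≟ suc n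
  ... | yes ≡.refl = Σ≤-cong (suc n) low
  ... | no  s≢1+n  =
    let s≤n = ℕ.s≤s⁻¹ (ℕ.≤∧≢⇒< s≤1+n s≢1+n) in
    trans (+-cong (high (suc n) (ℕ.s≤s s≤n)) (Σ≤-below s n s≤n low high)) (+-identityˡ _)

  -- Ideal membership: `q` is the cofactor with which a known relation enters `a - b`. The solver
  -- proves polynomial identities only, so each consequence of the root relations is supplied in the
  -- form of such cofactors.
  from-eq : ∀ {l r a b} q → l ≈ r → a ≈ b + q * (l - r) → a ≈ b
  from-eq {l} {r} {a} {b} q l≈r a≈ = begin
    a               ≈⟨ a≈ ⟩
    b + q * (l - r) ≈⟨ +-congˡ (*-congˡ (+-congʳ l≈r)) ⟩
    b + q * (r - r) ≈⟨ solve 3 (λ b q r → b :+ q :* (r :- r) := b) refl b q r ⟩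
    b               ∎

  from-eq₂ : ∀ {l r l′ r′ a b} q q′ → l ≈ r → l′ ≈ r′ →
             a ≈ b + q * (l - r) + q′ * (l′ - r′) → a ≈ b
  from-eq₂ q q′ h h′ a≈ = from-eq q h (from-eq q′ h′ a≈)

  module Params (m : ℕ) (x p u μ c⁻¹ : Carrier) where
    -- w is the square root of the discriminant.  The subtree below a word is counted by
    -- μ lamʳ if the word has heavy points and by κ lamʳ if it has none, for suitable r.
    M c y D w lam κ : Carrier
    M = nat m
    c = nat (suc m)
    y = x * x
    D = 𝟏 - M * y
    w = D - 𝟐 * y * μ
    lam = (μ + M) * c⁻¹
    κ = (𝟏 + p * x * μ) * u

    private
      :y : ∀ {n} → Polynomial n → Polynomial n
      :y x = x :* x
      :D : ∀ {n} → (x m : Polynomial n) → Polynomial n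
      :D x m = :1 :- m :* :y x
      :w : ∀ {n} → (x m μ : Polynomial n) → Polynomial n
      :w x m μ = :D x m :- :2 :* :y x :* μ
      :κ : ∀ {n} → (x p μ u : Polynomial n) → Polynomial n
      :κ x p μ u = (:1 :+ p :* x :* μ) :* u

    -- `μ-inverse` is the quadratic y μ² - D μ + 1 = 0. Its discriminant is D² - 4 y = 1 - 2 (m + 2)
    -- x² + m² x⁴, and `w` is y times the difference of its roots.
    record Roots : Set ℓ where
      field
        u-inverse : u * w ≈ 𝟏
        μ-inverse : μ * (D - y * μ) ≈ 𝟏
        c-inverse : c * c⁻¹ ≈ 𝟏

    module Equations (roots : Roots) where
      open Roots roots

      -- Because μ (D - y μ) = 1, the product (μ + M) (1 - y μ) equals 1 + M = c.
      lam-inverse : lam * (𝟏 - y * μ) ≈ 𝟏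
      lam-inverse = from-eq₂ c⁻¹ 𝟏 μ-inverse c-inverse
        (solve 4 (λ x m μ c⁻¹ → (μ :+ m) :* c⁻¹ :* (:1 :- :y x :* μ) :=
           :1 :+ c⁻¹ :* (μ :* (:D x m :- :y x :* μ) :- :1) :+ :1 :* ((:1 :+ m) :* c⁻¹ :- :1)) refl x M μ c⁻¹)

      c*lam : c * lam ≈ μ + M
      c*lam = from-eq (μ + M) c-inverse
        (solve 3 (λ m μ c⁻¹ → (:1 :+ m) :* ((μ :+ m) :* c⁻¹) :=
           μ :+ m :+ (μ :+ m) :* ((:1 :+ m) :* c⁻¹ :- :1)) refl M μ c⁻¹)

      -- The heavy recurrence at its lowest state s = m, where no two-cycle can be heavy.
      heavy-step : μ ≈ c * (y * (μ * lam)) + 𝟏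
      heavy-step = from-eq₂ 𝟏 (- (y * μ)) μ-inverse c*lam
        (solve 4 (λ x m μ l → μ := (:1 :+ m) :* (:y x :* (μ :* l)) :+ :1 :+
           :1 :* (μ :* (:D x m :- :y x :* μ) :- :1) :+
           (:- (:y x :* μ)) :* ((:1 :+ m) :* l :- (μ :+ m))) refl x M μ lam)

      -- Equivalent to w lam = 1 - c y lam², which follows from 1 = lam (1 - y μ) and c lam = μ + M.
      -- It is what the light recurrence becomes after division by (1 + p x μ) lamᵈ.
      u-step : u ≈ c * (y * (u * (lam * lam))) + lam
      u-step = sym (from-eq₂ (- lam) (u * y * lam) u-inverse c*lam
        (from-eq u lam-inverse
        (solve 5 (λ x m μ u l → (:1 :+ m) :* (:y x :* (u :* (l :* l))) :+ l :=
           u :+ (:- l) :* (u :* :w x m μ :- :1) :+ u :* :y x :* l :* ((:1 :+ m) :* l :- (μ :+ m))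
             :+ u :* (l :* (:1 :- :y x :* μ) :- :1)) refl x M μ u lam)))

      -- The inverse of `lam` being 1 - y μ, the heavy summands are differences of consecutive
      -- powers and their sum telescopes.
      lam-difference : ∀ d → y * (μ * lam ^ suc d) ≈ lam ^ suc d - lam ^ d
      lam-difference d = from-eq (- (lam ^ d)) lam-inverse
        (solve 4 (λ x μ l e → :y x :* (μ :* (l :* e)) :=
           l :* e :- e :+ (:- e) :* (l :* (:1 :- :y x :* μ) :- :1)) refl x μ lam (lam ^ d))

      -- The subtree entered by a two-cycle with `t` points above it: if `t` exceeds `m`, the new
      -- state is `t` whatever the old one was; otherwise it depends on the old word, through `a`.
      branch : Carrier → ℕ → Carrier
      branch a t with t ≤? m
      ... | yes _ = a
      ... | no  _ = μ * lam ^ (t ∸ m)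

      branch-≤ : ∀ {a t} → t ℕ.≤ m → branch a t ≡.≡ a
      branch-≤ {t = t} t≤m with t ≤? m
      ... | yes _   = ≡.refl
      ... | no  t≰m = contradiction t≤m t≰m

      branch-> : ∀ {a t} → m ℕ.< t → branch a t ≡.≡ μ * lam ^ (t ∸ m)
      branch-> {t = t} m<t with t ≤? m
      ... | yes t≤m = contradiction t≤m (ℕ.<⇒≱ m<t)
      ... | no  _   = ≡.refl

      Σ≤-branch₀ : ∀ a → Σ≤ m (branch a) ≈ c * a
      Σ≤-branch₀ a = trans (Σ≤-cong m λ t t≤m → reflexive (branch-≤ t≤m)) (Σ≤-const m a)

      Σ≤-branch : ∀ a d → y * Σ≤ (d ℕ.+ m) (branch a) ≈ y * (c * a) + (lam ^ d - 𝟏)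
      Σ≤-branch a zero = begin
        y * Σ≤ m (branch a)        ≈⟨ *-congˡ (Σ≤-branch₀ a) ⟩
        y * (c * a)                ≈⟨ solve 1 (λ e → e := e :+ (:1 :- :1)) refl (y * (c * a)) ⟩
        y * (c * a) + (𝟏 - 𝟏)      ≈⟨ +-congˡ (+-congʳ 1-homo) ⟩
        y * (c * a) + (1# - 𝟏)     ∎
      Σ≤-branch a (suc d) = begin
        y * (branch a (suc d ℕ.+ m) + Σ≤ (d ℕ.+ m) (branch a))
          ≈⟨ *-congˡ (+-congʳ (reflexive (≡.trans (branch-> (ℕ.s≤s (ℕ.m≤n+m m d)))
               (≡.cong (λ k → μ * lam ^ k) (ℕ.m+n∸n≡m (suc d) m))))) ⟩
        y * (μ * lam ^ suc d + Σ≤ (d ℕ.+ m) (branch a))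
          ≈⟨ distribˡ y _ _ ⟩
        y * (μ * lam ^ suc d) + y * Σ≤ (d ℕ.+ m) (branch a)
          ≈⟨ +-cong (lam-difference d) (Σ≤-branch a d) ⟩
        (lam ^ suc d - lam ^ d) + (y * (c * a) + (lam ^ d - 𝟏))
          ≈⟨ solve 3 (λ f e a → (f :- e) :+ (a :+ (e :- :1)) := a :+ (f :- :1)) refl
               (lam ^ suc d) (lam ^ d) (y * (c * a)) ⟩
        y * (c * a) + (lam ^ suc d - 𝟏) ∎

      -- Here `d` is s - m. The `𝟏` for the word itself cancels the -1 left by telescoping, and what
      -- remains is `heavy-step` times `lam ^ d`.
      heavy-kernel : ∀ d → μ * lam ^ d ≈ 𝟏 + y * Σ≤ (d ℕ.+ m) (branch (μ * lam ^ suc d))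
      heavy-kernel d = sym (begin
        𝟏 + y * Σ≤ (d ℕ.+ m) (branch (μ * lam ^ suc d))
          ≈⟨ +-congˡ (Σ≤-branch _ d) ⟩
        𝟏 + (y * (c * (μ * (lam * lam ^ d))) + (lam ^ d - 𝟏))
          ≈⟨ from-eq (- (lam ^ d)) heavy-step
               (solve 5 (λ x c μ l e → :1 :+ (:y x :* (c :* (μ :* (l :* e))) :+ (e :- :1)) :=
                  μ :* e :+ (:- e) :* (μ :- (c :* (:y x :* (μ :* l)) :+ :1))) refl x c μ lam (lam ^ d)) ⟩
        μ * lam ^ d ∎)

      -- Here `d` is n - (m + 1), so the sum runs up to t = n. A fixed point leads to the heavy
      -- state n, a light two-cycle to an all-light word with two more letters. After the constants
      -- cancel, `u-step` remains, times (1 + p x μ) lamᵈ.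
      light-kernel : ∀ d → κ * lam ^ d ≈
        𝟏 + x * (p * (μ * lam ^ suc d)) + y * Σ≤ (suc d ℕ.+ m) (branch (κ * lam ^ suc (suc d)))
      light-kernel d = sym (begin
        𝟏 + x * (p * (μ * lam ^ suc d)) + y * Σ≤ (suc d ℕ.+ m) (branch (κ * lam ^ suc (suc d)))
          ≈⟨ +-congˡ (Σ≤-branch _ (suc d)) ⟩
        𝟏 + x * (p * (μ * (lam * lam ^ d))) + (y * (c * (κ * (lam * (lam * lam ^ d)))) + (lam * lam ^ d - 𝟏))
          ≈⟨ from-eq (- ((𝟏 + p * x * μ) * lam ^ d)) u-step
               (solve 7 (λ x p c μ u l e →
                  :1 :+ x :* (p :* (μ :* (l :* e))) :+
                    (:y x :* (c :* (:κ x p μ u :* (l :* (l :* e)))) :+ (l :* e :- :1)) :=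
                  :κ x p μ u :* e :+ (:- ((:1 :+ p :* x :* μ) :* e)) :* (u :- (c :* (:y x :* (u :* (l :* l))) :+ l)))
                  refl x p c μ u lam (lam ^ d)) ⟩
        κ * lam ^ d ∎)

      -- Substitute y μ = (D - w) / 2; the term without `u` comes from u w = 1.
      κ-closed : y * κ ≈ - (½ * x * (p + (p * M * y - 𝟐 * x - p) * u))
      κ-closed = from-eq (- (½ * x * p)) u-inverse
        (solve 5 (λ x p m μ u → :y x :* :κ x p μ u :=
           :- (:½ :* x :* (p :+ (p :* m :* :y x :- :2 :* x :- p) :* u))
             :+ (:- (:½ :* x :* p)) :* (u :* :w x m μ :- :1)) refl x p M μ u)

      -- Replacing `c * lam` by `μ + M` makes the left side quadratic in `μ`; `μ-inverse` removes
      -- the square and `u-inverse` the remaining linear term.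
      lamκ-closed : x * y * (c * (lam * κ)) ≈
        - (½ * (x + p - (x * y * M - p * y * (M + 𝟐) + x + p) * u))
      lamκ-closed = from-eq₂ (x * y * κ) (- (½ * (x + p))) c*lam u-inverse
        (from-eq (- (p * y * u)) μ-inverse
        (solve 6 (λ x p m μ u l → x :* :y x :* ((:1 :+ m) :* (l :* :κ x p μ u)) :=
           :- (:½ :* (x :+ p :- (x :* :y x :* m :- p :* :y x :* (m :+ :2) :+ x :+ p) :* u))
             :+ x :* :y x :* :κ x p μ u :* ((:1 :+ m) :* l :- (μ :+ m))
             :+ (:- (:½ :* (x :+ p))) :* (u :* :w x m μ :- :1)
             :+ (:- (p :* :y x :* u)) :* (μ :* (:D x m :- :y x :* μ) :- :1)) refl x p M μ u lam))

      -- For m ≥ 1 the value of `q` is xᵐ⁻¹. For m = 0 the identity is applied to the equation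
      -- multiplied by x, with `q` the unit and `s` absorbing the extra factor.
      closed-form : ∀ s q J₁ J₀ → s + x * (x * q) * (κ * J₁ + x * (c * (lam * κ) * J₀)) ≈
        s - ½ * (x * q) * (p + (p * M * y - 𝟐 * x - p) * u) * J₁
          - ½ * q * (x + p - (x * y * M - p * y * (M + 𝟐) + x + p) * u) * J₀
      closed-form s q J₁ J₀ = from-eq₂ (q * J₁) (q * J₀) κ-closed lamκ-closed
        (solve 12 (λ s x q κ c lκ J₁ J₀ p m u y → s :+ x :* (x :* q) :* (κ :* J₁ :+ x :* (c :* lκ :* J₀)) :=
          s :- :½ :* (x :* q) :* (p :+ (p :* m :* y :- :2 :* x :- p) :* u) :* J₁
            :- :½ :* q :* (x :+ p :- (x :* y :* m :- p :* y :* (m :+ :2) :+ x :+ p) :* u) :* J₀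
            :+ q :* J₁ :* (x :* x :* κ :- (:- (:½ :* x :* (p :+ (p :* m :* y :- :2 :* x :- p) :* u))))
            :+ q :* J₀ :* (x :* (x :* x) :* (c :* lκ) :-
                 (:- (:½ :* (x :+ p :- (x :* y :* m :- p :* y :* (m :+ :2) :+ x :+ p) :* u)))))
          refl s x q κ c (lam * κ) J₁ J₀ p M u y)

-- Rational scalars in rings of series

RationalAlgebra : ∀ {a ℓ} → CommutativeRing a ℓ → Set _
RationalAlgebra R = ℚ.+-*-rawRing -Raw-AlmostCommutative⟶ fromCommutativeRing R

constantSeries : ∀ {a ℓ} (R : CommutativeRing a ℓ) → RationalAlgebra R →
  RationalAlgebra (PowerSeriesRing.commutativeRing R)
constantSeries R φ = record
  { ⟦_⟧    = λ q → C ⟦ q ⟧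
  ; +-homo = λ q r → ≈.trans (C-cong (+-homo q r)) (C-+ _ _)
  ; *-homo = λ q r → ≈.trans (C-cong (*-homo q r)) (C-* _ _)
  ; -‿homo = λ q → ≈.trans (C-cong (-‿homo q)) (C-neg _)
  ; 0-homo = ≈.trans (C-cong 0-homo) C-0
  ; 1-homo = C-cong 1-homo
  }
  where
  open PowerSeriesRing R
  open _-Raw-AlmostCommutative⟶_ φ
  module ≈ = CommutativeRing commutativeRing

module Integers {a ℓ} (R : CommutativeRing a ℓ) (φ : RationalAlgebra R) where
  open CommutativeRing R
  open Kernel R φ using (nat)
  open _-Raw-AlmostCommutative⟶_ φ
  open Rationals

  nat-rational : ∀ n → nat n ≈ ⟦ + n ℚ./ 1 ⟧
  nat-rational zero    = sym 0-homo
  nat-rational (suc n) = trans (+-congˡ (nat-rational n))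
    (trans (sym (+-homo _ _)) (reflexive (≡.cong ⟦_⟧ (≡.sym (/1-+ (+ 1) (+ n))))))

-- The square root of the discriminant as a series in x

module SquareRoot (m : ℕ) where
  import Data.Integer as ℤ
  open PowerSeriesRing ℚ.+-*-commutativeRing
  open Unfolding ℚ.+-*-commutativeRing using (unfold)
  open CommutativeRing commutativeRing

  φ : RationalAlgebra commutativeRing
  φ = constantSeries ℚ.+-*-commutativeRing (-raw-almostCommutative⟶ _)

  open RationalSolver commutativeRing φ
  open Kernel commutativeRing φ using (𝟏; 𝟐; nat)
  open Integers commutativeRing φ
  open Rationals
  open import Relation.Binary.Reasoning.Setoid setoid

  private
    :0 :1 :2 :¼ : ∀ {n} → Polynomial n
    :0 = con ℚ.0ℚ
    :1 = con ℚ.1ℚ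
    :2 = con (ℚ.1ℚ ℚ.+ ℚ.1ℚ)
    :¼ = con (ℚ.½ ℚ.* ℚ.½)

  k : ℕ
  k = suc (suc (suc m))

  -- μ is the power series (D − √Δ) / (2 x²), the division being a shift by two places.
  Δ u w₀ M y D h μ : Series
  Δ = discriminant k
  u = 1/√ Δ
  w₀ = u * Δ
  M = nat m
  y = X * X
  D = 𝟏 - M * y
  h = D - w₀
  μ n = ℚ.½ ℚ.* h (suc (suc n))

  uuΔ : u * u * Δ ≈ 𝟏
  uuΔ = 1/√-correct Δ ≡.refl

  Δ₂ : C (Δ 2) ≈ - (𝟐 * (𝟏 + (𝟏 + M)))
  Δ₂ = begin
    C ((ℤ.- (+ 2 ℤ.* + suc (suc m))) ℚ./ 1)
      ≈⟨ C-cong (≡.trans (/1-neg (+ 2 ℤ.* + suc (suc m))) (≡.cong ℚ.-_ (/1-* (+ 2) (+ suc (suc m))))) ⟩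
    C (ℚ.- ((+ 2 ℚ./ 1) ℚ.* (+ suc (suc m) ℚ./ 1)))
      ≈⟨ trans (C-neg _) (-‿cong (C-* (+ 2 ℚ./ 1) (+ suc (suc m) ℚ./ 1))) ⟩
    - (𝟐 * C (+ suc (suc m) ℚ./ 1))
      ≈⟨ -‿cong (*-congˡ {𝟐} (sym (nat-rational (suc (suc m))))) ⟩
    - (𝟐 * (𝟏 + (𝟏 + M))) ∎

  Δ₄ : C (Δ 4) ≈ M * M
  Δ₄ = begin
    C ((+ m ℤ.* + m) ℚ./ 1)                 ≈⟨ C-cong (/1-* (+ m) (+ m)) ⟩
    C ((+ m ℚ./ 1) ℚ.* (+ m ℚ./ 1))         ≈⟨ C-* (+ m ℚ./ 1) (+ m ℚ./ 1) ⟩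
    C (+ m ℚ./ 1) * C (+ m ℚ./ 1)           ≈⟨ *-cong (nat-rational m) (nat-rational m) ⟨
    M * M                                   ∎

  unfold² : ∀ a → a ≈ C (a 0) + X * (C (a 1) + X * tail (tail a))
  unfold² a = trans (unfold a) (+-congˡ {C (a 0)} (*-congˡ {X} (unfold (tail a))))

  -- Identifies the discriminant of the theorem with that of the quadratic for `μ`.
  Δ-closed : Δ ≈ D * D - 𝟐 * 𝟐 * y
  Δ-closed = begin
    Δ
      ≈⟨ unfold² Δ ⟩
    𝟏 + X * (𝟎 + X * tail (tail Δ))
      ≈⟨ +-congˡ {𝟏} (*-congˡ {X} (+-congˡ {𝟎} (*-congˡ {X} (unfold² (tail (tail Δ)))))) ⟩
    𝟏 + X * (𝟎 + X * (C (Δ 2) + X * (𝟎 + X * tail (tail (tail (tail Δ))))))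
      ≈⟨ +-congˡ {𝟏} (*-congˡ {X} (+-congˡ {𝟎} (*-congˡ {X} (+-cong Δ₂ (*-congˡ {X} (+-congˡ {𝟎} (*-congˡ {X} top))))))) ⟩
    𝟏 + X * (𝟎 + X * (- (𝟐 * (𝟏 + (𝟏 + M))) + X * (𝟎 + X * (M * M))))
      ≈⟨ solve 2 (λ x m → :1 :+ x :* (:0 :+ x :* ((:- (:2 :* (:1 :+ (:1 :+ m)))) :+ x :* (:0 :+ x :* (m :* m))))
           := (:1 :- m :* (x :* x)) :* (:1 :- m :* (x :* x)) :- :2 :* :2 :* (x :* x)) (λ _ → ≡.refl) X M ⟩
    D * D - 𝟐 * 𝟐 * y ∎
    where
    𝟎 : Series
    𝟎 = C ℚ.0ℚ
    top : tail (tail (tail (tail Δ))) ≈ M * M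
    top = trans (λ { zero → ≡.refl ; (suc n) → ≡.refl }) Δ₄

  M*y : M * y ≈ X * (X * M)
  M*y = solve 2 (λ x m → m :* (x :* x) := x :* (x :* m)) (λ _ → ≡.refl) X M

  -- The series D and √Δ agree in degrees 0 and 1, which makes the shift in `μ` an exact division by
  -- x². Those coefficients of `w₀` compute; only the ones of `M * y` need lemmas.
  h₀ : h 0 ≡ ℚ.0ℚ
  h₀ = ≡.cong (λ q → ℚ.1ℚ ℚ.- q ℚ.- ℚ.1ℚ) (≡.trans (M*y 0) (X-⊛-zero (X * M)))

  h₁ : h 1 ≡ ℚ.0ℚ
  h₁ = ≡.cong (λ q → ℚ.0ℚ ℚ.- q ℚ.- ℚ.0ℚ) (≡.trans (M*y 1) (≡.trans (X-⊛-suc (X * M) 0) (X-⊛-zero M)))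

  h≈ : h ≈ 𝟐 * y * μ
  h≈ = begin
    h
      ≈⟨ unfold² h ⟩
    C (h 0) + X * (C (h 1) + X * tail (tail h))
      ≈⟨ +-cong (C-cong h₀) (*-congˡ {X} (+-cong (C-cong h₁) (*-congˡ {X} tail²))) ⟩
    C ℚ.0ℚ + X * (C ℚ.0ℚ + X * (𝟐 * μ))
      ≈⟨ solve 2 (λ x μ → :0 :+ x :* (:0 :+ x :* (:2 :* μ)) := :2 :* (x :* x) :* μ) (λ _ → ≡.refl) X μ ⟩
    𝟐 * y * μ ∎
    where
    tail² : tail (tail h) ≈ 𝟐 * μ
    tail² n = ≡.sym (≡.trans (C-⊛ (ℚ.1ℚ ℚ.+ ℚ.1ℚ) μ n)
      (≡.trans (≡.sym (ℚ.*-assoc (ℚ.1ℚ ℚ.+ ℚ.1ℚ) ℚ.½ (h (suc (suc n))))) (ℚ.*-identityˡ _)))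

  w₀≈ : w₀ ≈ D - 𝟐 * y * μ
  w₀≈ = begin
    w₀                 ≈⟨ solve 2 (λ d w → w := d :- (d :- w)) (λ _ → ≡.refl) D w₀ ⟩
    D - h              ≈⟨ +-congˡ {D} (-‿cong h≈) ⟩
    D - 𝟐 * y * μ      ∎

  u-inverse : u * (D - 𝟐 * y * μ) ≈ 𝟏
  u-inverse = begin
    u * (D - 𝟐 * y * μ)  ≈⟨ *-congˡ {u} w₀≈ ⟨
    u * (u * Δ)          ≈⟨ *-assoc u u Δ ⟨
    u * u * Δ            ≈⟨ uuΔ ⟩
    𝟏                    ∎

  w₀² : w₀ * w₀ ≈ D * D - 𝟐 * 𝟐 * y
  w₀² = begin
    u * Δ * (u * Δ)      ≈⟨ solve 2 (λ u a → u :* a :* (u :* a) := u :* u :* a :* a) (λ _ → ≡.refl) u Δ ⟩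
    u * u * Δ * Δ        ≈⟨ *-congʳ {Δ} uuΔ ⟩
    𝟏 * Δ                ≈⟨ *-identityˡ Δ ⟩
    Δ                    ≈⟨ Δ-closed ⟩
    D * D - 𝟐 * 𝟐 * y    ∎

  -- 4 y μ (D - y μ) = D² - (D - 2 y μ)² = D² - Δ = 4 y. As x is not invertible, the identity is
  -- proved multiplied by x² and then cancelled.
  μ-inverse : μ * (D - y * μ) ≈ 𝟏
  μ-inverse = X-cancel (X-cancel (begin
    X * (X * (μ * (D - y * μ)))
      ≈⟨ solve 3 (λ x d μ → x :* (x :* (μ :* (d :- x :* x :* μ))) :=
           :¼ :* (d :* d :- (d :- :2 :* (x :* x) :* μ) :* (d :- :2 :* (x :* x) :* μ))) (λ _ → ≡.refl) X D μ ⟩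
    ¼ * (D * D - (D - 𝟐 * y * μ) * (D - 𝟐 * y * μ))
      ≈⟨ *-congˡ {¼} (+-congˡ {D * D} (-‿cong (trans (sym (*-cong w₀≈ w₀≈)) w₀²))) ⟩
    ¼ * (D * D - (D * D - 𝟐 * 𝟐 * y))
      ≈⟨ solve 2 (λ x d → :¼ :* (d :* d :- (d :* d :- :2 :* :2 :* (x :* x))) := x :* (x :* :1)) (λ _ → ≡.refl) X D ⟩
    X * (X * 𝟏) ∎))
    where
    ¼ : Series
    ¼ = C (ℚ.½ ℚ.* ℚ.½)

-- Series in x whose coefficients are series in p

module Bivariate where
  private
    module A = PowerSeriesRing ℚ.+-*-commutativeRing
    module A-ring = CommutativeRing A.commutativeRing
    φᴬ : RationalAlgebra A.commutativeRing
    φᴬ = constantSeries ℚ.+-*-commutativeRing (-raw-almostCommutative⟶ _)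
    module Kᴬ = Kernel A.commutativeRing φᴬ
  open PowerSeriesRing A.commutativeRing public
  open CommutativeRing commutativeRing

  φ : RationalAlgebra commutativeRing
  φ = constantSeries A.commutativeRing φᴬ

  open Kernel commutativeRing φ using (𝟏; 𝟐; nat)

  p : Series
  p = C A.X

  E : A.Series → Series
  E a n = A.C (a n)

  E-+ : ∀ a b → E (a A-ring.+ b) ≈ E a + E b
  E-+ a b n = A.C-+ (a n) (b n)

  E-neg : ∀ a → E (A-ring.- a) ≈ - E a
  E-neg a n = A.C-neg (a n)

  E-* : ∀ a b → E (a A-ring.* b) ≈ E a * E b
  E-* = SeriesMap.map-⊛ (CommutativeRing.rawRing ℚ.+-*-commutativeRing) A.commutativeRing A.C A.C-+ A.C-* A.C-0

  E-cong : ∀ {a b} → a A-ring.≈ b → E a ≈ E b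
  E-cong eq n = A.C-cong (eq n)

  E-C : ∀ q → E (A.C q) ≈ C (A.C q)
  E-C q zero    i = ≡.refl
  E-C q (suc n) i = A.C-0 i

  E-X : E A.X ≈ X
  E-X zero          = A.C-0
  E-X (suc zero)    = λ _ → ≡.refl
  E-X (suc (suc n)) = A.C-0

  E-nat : ∀ n → E (Kᴬ.nat n) ≈ nat n
  E-nat zero    i = A.C-0
  E-nat (suc n) = trans (E-+ Kᴬ.𝟏 (Kᴬ.nat n)) (+-cong (E-C ℚ.1ℚ) (E-nat n))

  module _ (m : ℕ) where
    private module √ = SquareRoot m
    open Rationals
    open Integers commutativeRing φ

    u μ c⁻¹ : Series
    u = E √.u
    μ = E √.μ
    c⁻¹ = C (A.C (1/suc m))

    open Kernel.Params commutativeRing φ m X p u μ c⁻¹ using (y; D; w; c; Roots)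

    E-y : E √.y ≈ y
    E-y = trans (E-* A.X A.X) (*-cong E-X E-X)

    E-D : E √.D ≈ D
    E-D = trans (E-+ Kᴬ.𝟏 (A-ring.- (√.M A-ring.* √.y))) (+-cong (E-C ℚ.1ℚ) (trans (E-neg (√.M A-ring.* √.y))
      (-‿cong (trans (E-* √.M √.y) (*-cong (E-nat m) E-y)))))

    u-inverse : u * w ≈ 𝟏
    u-inverse = trans (sym (trans (E-* √.u _) (*-congˡ {u} E-w))) (trans (E-cong √.u-inverse) (E-C ℚ.1ℚ))
      where
      E-w : E (√.D A-ring.- Kᴬ.𝟐 A-ring.* √.y A-ring.* √.μ) ≈ w
      E-w = trans (E-+ √.D (A-ring.- (Kᴬ.𝟐 A-ring.* √.y A-ring.* √.μ))) (+-cong E-D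
        (trans (E-neg (Kᴬ.𝟐 A-ring.* √.y A-ring.* √.μ)) (-‿cong (trans (E-* (Kᴬ.𝟐 A-ring.* √.y) √.μ) (*-congʳ {μ}
        (trans (E-* Kᴬ.𝟐 √.y) (*-cong (E-C (ℚ.1ℚ ℚ.+ ℚ.1ℚ)) E-y)))))))

    μ-inverse : μ * (D - y * μ) ≈ 𝟏
    μ-inverse = trans (sym (trans (E-* √.μ (√.D A-ring.- √.y A-ring.* √.μ)) (*-congˡ {μ} (trans
        (E-+ √.D (A-ring.- (√.y A-ring.* √.μ)))
        (+-cong E-D (trans (E-neg (√.y A-ring.* √.μ)) (-‿cong (trans (E-* √.y √.μ) (*-congʳ {μ} E-y)))))))))
      (trans (E-cong √.μ-inverse) (E-C ℚ.1ℚ))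

    c-inverse : c * c⁻¹ ≈ 𝟏
    c-inverse = trans (*-congʳ {c⁻¹} (nat-rational (suc m))) (trans (sym (*-homo (+ suc m ℚ./ 1) (1/suc m)))
      (λ n i → ≡.cong (λ q → C (A.C q) n i) (suc*1/suc m)))
      where open _-Raw-AlmostCommutative⟶_ φ using (*-homo)

    roots : Roots
    roots = record { u-inverse = u-inverse ; μ-inverse = μ-inverse ; c-inverse = c-inverse }

-- Involutions by insertion of the cycle of the first letter

module Insertion where
  open import Data.Fin using (zero; suc; punchIn; punchOut)
  open import Data.Fin.Properties using (_≟_; punchIn-injective; punchInᵢ≢i; punchIn-punchOut; suc-injective)
  open import Data.List using ([]; _∷_; _++_; map; allFin; cartesianProductWith)
  open import Data.List.Membership.Propositional using (_∈_)
  open import Data.List.Membership.Propositional.Properties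
    using (∈-allFin; ∈-map⁺; ∈-map⁻; ∈-++⁺ˡ; ∈-++⁺ʳ; ∈-cartesianProductWith⁺; ∈-cartesianProductWith⁻; ∈-filter⁺; ∈-filter⁻)
  open import Data.List.Membership.Propositional.Properties.WithK using (unique∧set⇒bag)
  open import Data.List.Relation.Binary.BagAndSetEquality using (∼bag⇒↭)
  open import Data.List.Relation.Binary.Permutation.Propositional using (_↭_)
  open import Data.List.Relation.Unary.All as All using (All; []; _∷_)
  import Data.List.Relation.Unary.All.Properties as All
  open import Data.List.Relation.Unary.AllPairs using ([]; _∷_)
  open import Data.List.Relation.Unary.Any using (here)
  open import Data.List.Relation.Unary.Unique.Propositional using (Unique)
  import Data.List.Relation.Unary.Unique.Propositional.Properties as Unique
  open import Data.Product using (∃; _×_; _,_; proj₁; proj₂)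
  open import Data.Vec as Vec using (Vec; []; _∷_; lookup; insertAt; tabulate)
  open import Data.Vec.Properties
    using (lookup-map; insertAt-lookup; insertAt-punchIn; removeAt-insertAt; lookup∘tabulate; tabulate∘lookup; tabulate-cong; ∷-injective)
  open import Function using (_∘_; mk⇔)
  open import Relation.Binary.PropositionalEquality
  open import Relation.Nullary using (yes; no; contradiction)

  data PunchView {n} (v : Fin (suc n)) : Fin (suc n) → Set where
    itself : PunchView v v
    other  : ∀ a → PunchView v (punchIn v a)

  punchView : ∀ {n} (v j : Fin (suc n)) → PunchView v j
  punchView v j with v ≟ j
  ... | yes refl = itself
  ... | no  v≢j  = subst (PunchView v) (punchIn-punchOut v≢j) (other (punchOut v≢j))

  lookup-injective : ∀ {a} {A : Set a} {n} {xs ys : Vec A n} → (∀ i → lookup xs i ≡ lookup ys i) → xs ≡ ys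
  lookup-injective {xs = xs} {ys} eq =
    trans (sym (tabulate∘lookup xs)) (trans (tabulate-cong eq) (tabulate∘lookup ys))

  map-injective : ∀ {a b} {A : Set a} {B : Set b} {f : A → B} → (∀ {x y} → f x ≡ f y → x ≡ y) →
    ∀ {n} {xs ys : Vec A n} → Vec.map f xs ≡ Vec.map f ys → xs ≡ ys
  map-injective f-inj {xs = []}     {[]}     eq = refl
  map-injective f-inj {xs = x ∷ xs} {y ∷ ys} eq =
    cong₂ _∷_ (f-inj (proj₁ (∷-injective eq))) (map-injective f-inj (proj₂ (∷-injective eq)))

  Involutive : ∀ {n} → Word n → Set
  Involutive π = ∀ i → lookup π (lookup π i) ≡ i

  involutive-injective : ∀ {n} (π : Word n) → Involutive π → ∀ {i j} → lookup π i ≡ lookup π j → i ≡ j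
  involutive-injective π inv {i} {j} eq = trans (sym (inv i)) (trans (cong (lookup π) eq) (inv j))

  involution : ∀ {n} (π : Word n) → Involutive π → IsInvolution π
  involution π inv =
    (involutive-injective π inv , λ y → lookup π y , λ eq → trans (cong (lookup π) eq) (inv y)) , inv

  addFixed : ∀ {n} → Word n → Word (suc n)
  addFixed π = zero ∷ Vec.map suc π

  -- In the result, positions and values 0 and 1 + v form a two-cycle.
  addSwap : ∀ {n} → Fin (suc n) → Word n → Word (suc (suc n))
  addSwap v π = suc v ∷ insertAt (Vec.map (suc ∘ punchIn v) π) v zero

  lookup-addFixed : ∀ {n} (π : Word n) i → lookup (addFixed π) (suc i) ≡ suc (lookup π i)
  lookup-addFixed π i = lookup-map i suc π

  lookup-addSwap-self : ∀ {n} v (π : Word n) → lookup (addSwap v π) (suc v) ≡ zero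
  lookup-addSwap-self v π = insertAt-lookup (Vec.map (suc ∘ punchIn v) π) v zero

  lookup-addSwap : ∀ {n} v (π : Word n) a →
    lookup (addSwap v π) (suc (punchIn v a)) ≡ suc (punchIn v (lookup π a))
  lookup-addSwap v π a =
    trans (insertAt-punchIn (Vec.map (suc ∘ punchIn v) π) v zero a) (lookup-map a (suc ∘ punchIn v) π)

  addFixed-involutive : ∀ {n} (π : Word n) → Involutive π → Involutive (addFixed π)
  addFixed-involutive π inv zero = refl
  addFixed-involutive π inv (suc i) =
    trans (cong (lookup (addFixed π)) (lookup-addFixed π i))
          (trans (lookup-addFixed π (lookup π i)) (cong suc (inv i)))

  addSwap-involutive : ∀ {n} v (π : Word n) → Involutive π → Involutive (addSwap v π)
  addSwap-involutive v π inv zero = lookup-addSwap-self v π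
  addSwap-involutive v π inv (suc j) with punchView v j
  ... | itself  = cong (lookup (addSwap v π)) (lookup-addSwap-self v π)
  ... | other a =
    trans (cong (lookup (addSwap v π)) (lookup-addSwap v π a))
          (trans (lookup-addSwap v π (lookup π a)) (cong (suc ∘ punchIn v) (inv a)))

  addFixed-injective : ∀ {n} {π ρ : Word n} → addFixed π ≡ addFixed ρ → π ≡ ρ
  addFixed-injective eq = map-injective suc-injective (proj₂ (∷-injective eq))

  addSwap-injective : ∀ {n v w} {π ρ : Word n} → addSwap v π ≡ addSwap w ρ → v ≡ w × π ≡ ρ
  addSwap-injective {v = v} {w} {π} {ρ} eq with ∷-injective eq
  ... | refl , tails≡ = refl , map-injective (λ e → punchIn-injective v _ _ (suc-injective e))
    (trans (sym (removeAt-insertAt _ v zero)) (trans (cong (λ xs → Vec.removeAt xs v) tails≡) (removeAt-insertAt _ v zero)))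

  addFixed≢addSwap : ∀ {n v} {π : Word (suc n)} {ρ : Word n} → addFixed π ≢ addSwap v ρ
  addFixed≢addSwap eq with ∷-injective eq
  ... | () , _

  removeFixed : ∀ {n} (π : Word (suc n)) → Involutive π → lookup π zero ≡ zero →
    ∃ λ ρ → Involutive ρ × addFixed ρ ≡ π
  removeFixed {n} π inv π₀ = ρ , ρ-inv , lookup-injective same
    where
    pick : ∀ i → ∃ λ b → suc b ≡ lookup π (suc i)
    pick i with lookup π (suc i) in eq
    ... | zero  = contradiction (trans (sym (inv (suc i))) (trans (cong (lookup π) eq) π₀)) λ ()
    ... | suc b = b , refl
    ρ : Word n
    ρ = tabulate (proj₁ ∘ pick)
    lookup-ρ : ∀ i → suc (lookup ρ i) ≡ lookup π (suc i)
    lookup-ρ i = trans (cong suc (lookup∘tabulate (proj₁ ∘ pick) i)) (proj₂ (pick i))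
    ρ-inv : Involutive ρ
    ρ-inv i = suc-injective (trans (lookup-ρ (lookup ρ i)) (trans (cong (lookup π) (lookup-ρ i)) (inv (suc i))))
    same : ∀ i → lookup (addFixed ρ) i ≡ lookup π i
    same zero    = sym π₀
    same (suc i) = trans (lookup-addFixed ρ i) (lookup-ρ i)

  -- The values `zero` and `suc v` are taken at the positions `suc v` and `zero`, so every other
  -- position holds some `suc (punchIn v b)`, and `b` can be read off.
  removeSwap : ∀ {n} v (π : Word (suc (suc n))) → Involutive π → lookup π zero ≡ suc v →
    ∃ λ ρ → Involutive ρ × addSwap v ρ ≡ π
  removeSwap {n} v π inv π₀ = ρ , ρ-inv , lookup-injective same
    where
    πv : lookup π (suc v) ≡ zero
    πv = trans (cong (lookup π) (sym π₀)) (inv zero)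
    pick : ∀ a → ∃ λ b → suc (punchIn v b) ≡ lookup π (suc (punchIn v a))
    pick a with lookup π (suc (punchIn v a)) in eq
    ... | zero = contradiction
      (suc-injective (trans (sym (inv (suc (punchIn v a)))) (trans (cong (lookup π) eq) π₀))) (punchInᵢ≢i v a)
    ... | suc j with punchView v j
    ...   | itself  = contradiction (trans (sym (inv (suc (punchIn v a)))) (trans (cong (lookup π) eq) πv)) λ ()
    ...   | other b = b , refl
    ρ : Word n
    ρ = tabulate (proj₁ ∘ pick)
    lookup-ρ : ∀ a → suc (punchIn v (lookup ρ a)) ≡ lookup π (suc (punchIn v a))
    lookup-ρ a = trans (cong (suc ∘ punchIn v) (lookup∘tabulate (proj₁ ∘ pick) a)) (proj₂ (pick a))
    ρ-inv : Involutive ρ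
    ρ-inv a = punchIn-injective v _ _ (suc-injective
      (trans (lookup-ρ (lookup ρ a)) (trans (cong (lookup π) (lookup-ρ a)) (inv (suc (punchIn v a))))))
    same : ∀ i → lookup (addSwap v ρ) i ≡ lookup π i
    same zero    = sym π₀
    same (suc j) with punchView v j
    ... | itself  = trans (lookup-addSwap-self v ρ) (sym πv)
    ... | other a = trans (lookup-addSwap v ρ a) (lookup-ρ a)

  involutions : ∀ n → List (Word n)
  involutions zero          = [] ∷ []
  involutions (suc zero)    = addFixed [] ∷ []
  involutions (suc (suc n)) =
    map addFixed (involutions (suc n)) ++ cartesianProductWith addSwap (allFin (suc n)) (involutions n)

  ∈-involutions⁺ : ∀ n (π : Word n) → Involutive π → π ∈ involutions n
  ∈-involutions⁺ zero       []          inv = here refl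
  ∈-involutions⁺ (suc zero) (zero ∷ []) inv = here refl
  ∈-involutions⁺ (suc (suc n)) π inv = insert (∈-involutions⁺ (suc n)) (∈-involutions⁺ n)
    where
    insert : (∀ ρ → Involutive ρ → ρ ∈ involutions (suc n)) → (∀ ρ → Involutive ρ → ρ ∈ involutions n) →
             π ∈ involutions (suc (suc n))
    insert ∈₁ ∈₂ with lookup π zero in π₀
    ... | zero  = let ρ , ρ-inv , eq = removeFixed π inv π₀ in
      subst (_∈ _) eq (∈-++⁺ˡ (∈-map⁺ addFixed (∈₁ ρ ρ-inv)))
    ... | suc v = let ρ , ρ-inv , eq = removeSwap v π inv π₀ in
      subst (_∈ _) eq (∈-++⁺ʳ (map addFixed (involutions (suc n)))
        (∈-cartesianProductWith⁺ addSwap (∈-allFin v) (∈₂ ρ ρ-inv)))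

  involutions-involutive : ∀ n → All Involutive (involutions n)
  involutions-involutive zero          = (λ ()) ∷ []
  involutions-involutive (suc zero)    = addFixed-involutive [] (λ ()) ∷ []
  involutions-involutive (suc (suc n)) = All.++⁺
    (All.map⁺ (All.map (λ {π} → addFixed-involutive π) (involutions-involutive (suc n))))
    (All.cartesianProductWith⁺ (setoid _) (setoid _) addSwap (allFin (suc n)) (involutions n)
      λ {v} {π} _ π∈ → addSwap-involutive v π (All.lookup (involutions-involutive n) π∈))

  involutions-unique : ∀ n → Unique (involutions n)
  involutions-unique zero          = [] ∷ []
  involutions-unique (suc zero)    = [] ∷ []
  involutions-unique (suc (suc n)) = Unique.++⁺
    (Unique.map⁺ addFixed-injective (involutions-unique (suc n)))
    (Unique.cartesianProductWith⁺ addSwap addSwap-injective (Unique.allFin⁺ (suc n)) (involutions-unique n))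
    λ (∈ˡ , ∈ʳ) → disjoint ∈ˡ ∈ʳ
    where
    disjoint : ∀ {π} → π ∈ map addFixed (involutions (suc n)) →
      π ∈ cartesianProductWith addSwap (allFin (suc n)) (involutions n) → _
    disjoint ∈ˡ ∈ʳ with ∈-map⁻ addFixed ∈ˡ | ∈-cartesianProductWith⁻ addSwap (allFin (suc n)) (involutions n) ∈ʳ
    ... | _ , _ , refl | _ , _ , _ , _ , eq = addFixed≢addSwap eq

  vectors-unique : ∀ n m → Unique (vectors n m)
  vectors-unique n zero    = [] ∷ []
  vectors-unique n (suc m) = Unique.cartesianProductWith⁺ _∷_ ∷-injective (Unique.allFin⁺ n) (vectors-unique n m)

  -- Both lists are free of repetitions and have the same members. Sums over involutions may thus
  -- follow the recursive enumeration.
  ℐ↭involutions : ∀ n → ℐ n ↭ involutions n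
  ℐ↭involutions n = ∼bag⇒↭ (unique∧set⇒bag
    (Unique.filter⁺ isInvolution? (vectors-unique n n)) (involutions-unique n)
    (mk⇔ ⊆ ⊇))
    where
    ⊆ : ∀ {π} → π ∈ ℐ n → π ∈ involutions n
    ⊆ π∈ = ∈-involutions⁺ n _ (proj₂ (proj₂ (∈-filter⁻ isInvolution? {xs = vectors n n} π∈)))
    ⊇ : ∀ {π} → π ∈ involutions n → π ∈ ℐ n
    ⊇ {π} π∈ = ∈-filter⁺ isInvolution? (∈-vectors π) (involution π (All.lookup (involutions-involutive n) π∈))

-- Counting by indicator sums

module Counting where
  open import Data.Nat using (ℕ; zero; suc; _+_; _∸_; _≤_; _<_; _≤?_; z≤n; s≤s; s≤s⁻¹)
  import Data.Nat.Properties as ℕ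
  open import Data.Fin as Fin using (Fin; zero; suc; toℕ; punchIn; punchOut)
  import Data.Fin.Properties as Fin
  open import Algebra.Properties.CommutativeMonoid.Sum ℕ.+-0-commutativeMonoid public
    using (sum; sum-remove; sum-cong-≗; sum-permute)
  open import Data.Product using (∃; _×_; _,_)
  open import Function using (_∘_; _⇔_; mk⇔; Equivalence)
  open import Relation.Binary.PropositionalEquality
  open import Relation.Nullary using (¬_; Dec; yes; no; contradiction)
  open import Relation.Unary using (Decidable)

  indicator : ∀ {P : Set} → Dec P → ℕ
  indicator (yes _) = 1
  indicator (no  _) = 0

  indicator-yes : ∀ {P : Set} (P? : Dec P) → P → indicator P? ≡ 1
  indicator-yes (yes _) p = refl
  indicator-yes (no ¬p) p = contradiction p ¬p

  indicator-no : ∀ {P : Set} (P? : Dec P) → ¬ P → indicator P? ≡ 0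
  indicator-no (yes p) ¬p = contradiction p ¬p
  indicator-no (no _)  ¬p = refl

  indicator-mono : ∀ {P Q : Set} (P? : Dec P) (Q? : Dec Q) → (P → Q) → indicator P? ≤ indicator Q?
  indicator-mono (yes p) Q? P⇒Q = ℕ.≤-reflexive (sym (indicator-yes Q? (P⇒Q p)))
  indicator-mono (no _)  Q? P⇒Q = z≤n

  indicator-cong : ∀ {P Q : Set} (P? : Dec P) (Q? : Dec Q) → P ⇔ Q → indicator P? ≡ indicator Q?
  indicator-cong P? Q? e =
    ℕ.≤-antisym (indicator-mono P? Q? (Equivalence.to e)) (indicator-mono Q? P? (Equivalence.from e))

  sum-mono : ∀ {n} {f g : Fin n → ℕ} → (∀ i → f i ≤ g i) → sum f ≤ sum g
  sum-mono {zero}  f≤g = z≤n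
  sum-mono {suc n} f≤g = ℕ.+-mono-≤ (f≤g zero) (sum-mono (f≤g ∘ suc))

  sum-mono-< : ∀ {n} {f g : Fin n → ℕ} → (∀ i → f i ≤ g i) → ∀ j → f j < g j → sum f < sum g
  sum-mono-< f≤g zero    lt = ℕ.+-mono-<-≤ lt (sum-mono (f≤g ∘ suc))
  sum-mono-< f≤g (suc j) lt = ℕ.+-mono-≤-< (f≤g zero) (sum-mono-< (f≤g ∘ suc) j lt)

  sum-zero : ∀ {n} {f : Fin n → ℕ} → (∀ i → f i ≡ 0) → sum f ≡ 0
  sum-zero {zero}  f≡0 = refl
  sum-zero {suc n} f≡0 = cong₂ _+_ (f≡0 zero) (sum-zero (f≡0 ∘ suc))

  sum-one : ∀ {n} {f : Fin n → ℕ} → (∀ i → f i ≡ 1) → sum f ≡ n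
  sum-one {zero}  f≡1 = refl
  sum-one {suc n} f≡1 = cong₂ _+_ (f≡1 zero) (sum-one (f≡1 ∘ suc))

  count-≥ : ∀ n k → sum {n} (λ l → indicator (k ≤? toℕ l)) ≡ n ∸ k
  count-≥ zero    k       = sym (ℕ.0∸n≡0 k)
  count-≥ (suc n) zero    = sum-one {suc n} λ i → indicator-yes (0 ≤? toℕ i) z≤n
  count-≥ (suc n) (suc k) = trans
    (sum-cong-≗ {n} λ i → indicator-cong (suc k ≤? suc (toℕ i)) (k ≤? toℕ i) (mk⇔ s≤s⁻¹ s≤s))
    (count-≥ n k)


  -- Pigeonhole by induction on `q`: the position `f zero` is deleted and the remaining ones are
  -- renumbered by `punchOut`.
  count-injection : ∀ {q n} {P : Fin n → Set} (P? : Decidable P) (f : Fin q → Fin n) →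
    (∀ {a b} → f a ≡ f b → a ≡ b) → (∀ a → P (f a)) → q ≤ sum (λ i → indicator (P? i))
  count-injection {zero}          P? f f-inj Pf = z≤n
  count-injection {suc q} {zero}  P? f f-inj Pf with () ← f zero
  count-injection {suc q} {suc n} {P} P? f f-inj Pf = begin
    1 + q
      ≤⟨ s≤s (count-injection (λ i → P? (punchIn f₀ i)) rest
           (λ {a} {b} eq → Fin.suc-injective (f-inj (Fin.punchOut-injective (≢₀ a) (≢₀ b) eq)))
           λ a → subst P (sym (Fin.punchIn-punchOut (≢₀ a))) (Pf (suc a))) ⟩
    1 + sum (λ i → indicator (P? (punchIn f₀ i)))
      ≡⟨ cong (_+ sum (λ i → indicator (P? (punchIn f₀ i)))) (indicator-yes (P? f₀) (Pf zero)) ⟨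
    indicator (P? f₀) + sum (λ i → indicator (P? (punchIn f₀ i)))
      ≡⟨ sum-remove {n} {f₀} (λ i → indicator (P? i)) ⟨
    sum (λ i → indicator (P? i)) ∎
    where
    open ℕ.≤-Reasoning
    f₀ = f zero
    ≢₀ : ∀ a → f₀ ≢ f (suc a)
    ≢₀ a eq with () ← f-inj eq
    rest : Fin q → Fin n
    rest a = punchOut (≢₀ a)

  count-increasing : ∀ q {n} {P : Fin n → Set} (P? : Decidable P) → q ≤ sum (λ i → indicator (P? i)) →
    ∃ λ (f : Fin q → Fin n) → (∀ {a b} → a Fin.< b → f a Fin.< f b) × (∀ a → P (f a))
  count-increasing zero            P? q≤ = (λ ()) , (λ { {()} }) , λ ()
  count-increasing (suc q) {suc n} P? q≤ with P? zero
  ... | no _ = let f , f-mono , Pf = count-increasing (suc q) (P? ∘ suc) q≤ in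
    suc ∘ f , (λ lt → s≤s (f-mono lt)) , Pf
  ... | yes P₀ with count-increasing q (P? ∘ suc) (s≤s⁻¹ q≤)
  ...   | f , f-mono , Pf = g , g-mono , λ { zero → P₀ ; (suc a) → Pf a }
    where
    g : Fin (suc q) → Fin (suc n)
    g zero    = zero
    g (suc a) = suc (f a)
    g-mono : ∀ {a b} → a Fin.< b → g a Fin.< g b
    g-mono {zero}  {suc b} lt = s≤s z≤n
    g-mono {suc a} {suc b} lt = s≤s (f-mono (s≤s⁻¹ lt))

  injective⇒surjective : ∀ {n} (f : Fin n → Fin n) → (∀ {a b} → f a ≡ f b → a ≡ b) → ∀ y → ∃ λ i → f i ≡ y
  injective⇒surjective {suc n} f f-inj y with Fin.any? (λ i → f i Fin.≟ y)
  ... | yes found = found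
  ... | no  none  = contradiction
    (Fin.injective⇒≤ {f = λ i → punchOut (≢y i)} λ {a} {b} eq → f-inj (Fin.punchOut-injective (≢y a) (≢y b) eq))
    ℕ.1+n≰n
    where
    ≢y : ∀ i → y ≢ f i
    ≢y i eq = none (i , sym eq)

-- North-east counts under insertion

module Light where
  open import Data.Nat using (ℕ; zero; suc; _+_; _∸_; _≤_; _<_; _≤?_; z≤n; s≤s; s≤s⁻¹)
  import Data.Nat.Properties as ℕ
  open import Data.Fin as Fin using (Fin; zero; suc; toℕ; punchIn)
  import Data.Fin.Properties as Fin
  import Data.Fin.Permutation as Permutation
  open import Data.Product using (_×_; _,_; proj₁)
  open import Data.Vec using (lookup)
  open import Function using (mk⇔)
  open import Relation.Binary.PropositionalEquality
  open import Relation.Nullary using (yes; no; contradiction)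
  open import Relation.Nullary.Decidable using (_×-dec_)
  open import Relation.Unary using (Decidable)
  open Insertion
  open Counting

  punchIn-≥ : ∀ {n} (v : Fin (suc n)) (b : Fin n) → toℕ v ≤ toℕ b → toℕ (punchIn v b) ≡ suc (toℕ b)
  punchIn-≥ zero    b       v≤b = refl
  punchIn-≥ (suc v) (suc b) v≤b = cong suc (punchIn-≥ v b (s≤s⁻¹ v≤b))

  punchIn-< : ∀ {n} (v : Fin (suc n)) (b : Fin n) → toℕ b < toℕ v → toℕ (punchIn v b) ≡ toℕ b
  punchIn-< (suc v) zero    b<v = refl
  punchIn-< (suc v) (suc b) b<v = cong suc (punchIn-< v b (s≤s⁻¹ b<v))

  ≤punchIn : ∀ {n} (v : Fin (suc n)) (b : Fin n) → toℕ b ≤ toℕ (punchIn v b)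
  ≤punchIn v b with toℕ v ≤? toℕ b
  ... | yes v≤b = ℕ.≤-trans (ℕ.n≤1+n _) (ℕ.≤-reflexive (sym (punchIn-≥ v b v≤b)))
  ... | no  v≰b = ℕ.≤-reflexive (sym (punchIn-< v b (ℕ.≰⇒> v≰b)))

  punchIn-mono-< : ∀ {n} (v : Fin (suc n)) {a b : Fin n} → a Fin.< b → punchIn v a Fin.< punchIn v b
  punchIn-mono-< v {a} {b} a<b = ℕ.≰⇒> (λ le → ℕ.<⇒≱ a<b (Fin.punchIn-cancel-≤ v b a le))

  punchIn-cancel-< : ∀ {n} (v : Fin (suc n)) {a b : Fin n} → punchIn v a Fin.< punchIn v b → a Fin.< b
  punchIn-cancel-< v {a} {b} lt = ℕ.≰⇒> (λ le → ℕ.<⇒≱ lt (Fin.punchIn-mono-≤ v b a le))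

  <punchIn : ∀ {n} (v : Fin (suc n)) (b : Fin n) → toℕ v ≤ toℕ b → v Fin.< punchIn v b
  <punchIn v b v≤b = ℕ.≤-trans (s≤s v≤b) (ℕ.≤-reflexive (sym (punchIn-≥ v b v≤b)))

  <punchIn⁻ : ∀ {n} (v : Fin (suc n)) (b : Fin n) → v Fin.< punchIn v b → toℕ v ≤ toℕ b
  <punchIn⁻ v b lt with toℕ v ≤? toℕ b
  ... | yes v≤b = v≤b
  ... | no  v≰b = contradiction (ℕ.<-trans (ℕ.≤-trans lt (ℕ.≤-reflexive (punchIn-< v b (ℕ.≰⇒> v≰b)))) (ℕ.≰⇒> v≰b)) (ℕ.<-irrefl refl)

  _NorthEastOf_In_ : ∀ {n} → Fin n → Fin n → Word n → Set
  l NorthEastOf j In π = j Fin.< l × lookup π j Fin.< lookup π l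

  northEast? : ∀ {n} (π : Word n) j → Decidable (λ l → l NorthEastOf j In π)
  northEast? π j l = (j Fin.<? l) ×-dec (lookup π j Fin.<? lookup π l)

  ne : ∀ {n} → Word n → Fin n → ℕ
  ne π j = sum λ l → indicator (northEast? π j l)

  ne-bound : ∀ {n} (π : Word n) j → ne π j ≤ n ∸ suc (toℕ j)
  ne-bound {n} π j = ℕ.≤-trans
    (sum-mono {n} λ l → indicator-mono (northEast? π j l) (suc (toℕ j) ≤? toℕ l) proj₁)
    (ℕ.≤-reflexive (count-≥ n (suc (toℕ j))))

  -- The graph of an involution is symmetric in the diagonal, and this reflection preserves the
  -- north-east relation.
  ne-symmetric : ∀ {n} (π : Word n) → Involutive π → ∀ j → ne π (lookup π j) ≡ ne π j
  ne-symmetric {n} π inv j = trans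
    (sum-permute (λ l → indicator (northEast? π (lookup π j) l)) perm)
    (sum-cong-≗ {n} λ l → indicator-cong (northEast? π (lookup π j) (lookup π l)) (northEast? π j l)
      (mk⇔ (λ (s , t) → subst₂ Fin._<_ (inv j) (inv l) t , s)
           (λ (s , t) → t , subst₂ Fin._<_ (sym (inv j)) (sym (inv l)) s)))
    where
    perm : Permutation.Permutation′ n
    perm = Permutation.permutation (lookup π) (lookup π) inv inv

  ne-addFixed-zero : ∀ {n} (π : Word n) → ne (addFixed π) zero ≡ n
  ne-addFixed-zero {n} π = sum-one {n} λ l → indicator-yes (northEast? (addFixed π) zero (suc l))
    (s≤s z≤n , subst (λ z → 0 < toℕ z) (sym (lookup-addFixed π l)) (s≤s z≤n))

  ne-addFixed : ∀ {n} (π : Word n) a → ne (addFixed π) (suc a) ≡ ne π a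
  ne-addFixed {n} π a = sum-cong-≗ {n} λ l →
    indicator-cong (northEast? (addFixed π) (suc a) (suc l)) (northEast? π a l)
      (mk⇔ (λ (s , t) → s≤s⁻¹ s , s≤s⁻¹ (subst₂ Fin._<_ (lookup-addFixed π a) (lookup-addFixed π l) t))
           (λ (s , t) → s≤s s , subst₂ Fin._<_ (sym (lookup-addFixed π a)) (sym (lookup-addFixed π l)) (s≤s t)))

  sum-addSwap : ∀ {n} (v : Fin (suc n)) (f : Fin (suc (suc n)) → ℕ) →
    f zero ≡ 0 → f (suc v) ≡ 0 → sum f ≡ sum (λ l → f (suc (punchIn v l)))
  sum-addSwap {n} v f f₀ fᵥ = cong₂ _+_ f₀ (trans (sum-remove {n} {v} (λ l → f (suc l))) (cong (_+ sum (λ l → f (suc (punchIn v l)))) fᵥ))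

  -- The new point at position `zero` lies left of every old point and the one at `suc v` lies below
  -- every old point, so neither is north-east of an old one.
  ne-addSwap : ∀ {n} v (π : Word n) a → ne (addSwap v π) (suc (punchIn v a)) ≡ ne π a
  ne-addSwap {n} v π a = trans
    (sum-addSwap v (λ l → indicator (northEast? π′ j l))
      (indicator-no (northEast? π′ j zero) λ { (() , _) })
      (indicator-no (northEast? π′ j (suc v)) λ (_ , t) → ℕ.n≮0 (subst (lookup π′ j Fin.<_) (lookup-addSwap-self v π) t)))
    (sum-cong-≗ {n} λ l → indicator-cong (northEast? π′ j (suc (punchIn v l))) (northEast? π a l)
      (mk⇔ (λ (s , t) → punchIn-cancel-< v (s≤s⁻¹ s) ,
                        punchIn-cancel-< v (s≤s⁻¹ (subst₂ Fin._<_ (lookup-addSwap v π a) (lookup-addSwap v π l) t)))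
           (λ (s , t) → s≤s (punchIn-mono-< v s) ,
                        subst₂ Fin._<_ (sym (lookup-addSwap v π a)) (sym (lookup-addSwap v π l)) (s≤s (punchIn-mono-< v t)))))
    where
    π′ = addSwap v π
    j = suc (punchIn v a)

  -- The point at `suc v` has the least value, so everything to its right is north-east of it.
  ne-addSwap-self : ∀ {n} v (π : Word n) → ne (addSwap v π) (suc v) ≡ n ∸ toℕ v
  ne-addSwap-self {n} v π = trans
    (trans
      (sum-addSwap v (λ l → indicator (northEast? π′ (suc v) l))
        (indicator-no (northEast? π′ (suc v) zero) λ { (() , _) })
        (indicator-no (northEast? π′ (suc v) (suc v)) λ (s , _) → ℕ.<-irrefl refl s))
      (sum-cong-≗ {n} λ l → indicator-cong (northEast? π′ (suc v) (suc (punchIn v l))) (toℕ v ≤? toℕ l)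
        (mk⇔ (λ (s , _) → <punchIn⁻ v l (s≤s⁻¹ s))
             (λ v≤l → s≤s (<punchIn v l v≤l) ,
                      subst₂ Fin._<_ (sym (lookup-addSwap-self v π)) (sym (lookup-addSwap v π l)) (s≤s z≤n)))))
    (count-≥ n (toℕ v))
    where
    π′ = addSwap v π

  ne-addSwap-zero : ∀ {n} v (π : Word n) → Involutive π → ne (addSwap v π) zero ≡ n ∸ toℕ v
  ne-addSwap-zero v π inv =
    trans (sym (ne-symmetric (addSwap v π) (addSwap-involutive v π inv) zero)) (ne-addSwap-self v π)

-- The state of a word and its change under insertion

module States (m : ℕ) where
  open import Data.Nat using (zero; suc; _+_; _∸_; _≤_; _<_; _≤?_; z≤n; s≤s; s≤s⁻¹)
  import Data.Nat.Properties as ℕ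
  open import Data.Fin as Fin using (Fin; zero; suc; toℕ; punchIn)
  import Data.Fin.Properties as Fin
  open import Data.Product using (∃; _×_; _,_; proj₁; proj₂)
  open import Data.Vec using (lookup)
  open import Relation.Binary.PropositionalEquality
  open import Relation.Nullary using (Dec; yes; no; contradiction)
  open import Relation.Nullary.Decidable using (_→-dec_)
  open Insertion
  open Light

  Light : ∀ {n} → Word n → Fin n → Set
  Light π j = ne π j ≤ m

  Good : ∀ {n} → Word n → Set
  Good π = ∀ i j → i Fin.< j → lookup π i Fin.< lookup π j → Light π j

  abstract
    good? : ∀ {n} (π : Word n) → Dec (Good π)
    good? π = Fin.all? λ i → Fin.all? λ j →
      (i Fin.<? j) →-dec ((lookup π i Fin.<? lookup π j) →-dec (ne π j ≤? m))

  LightEnd : ∀ {n} → Word n → ℕ → Set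
  LightEnd {n} π k = ∀ j → n ≤ k + toℕ j → Light π j

  lightEnd? : ∀ {n} (π : Word n) k → Dec (LightEnd π k)
  lightEnd? {n} π k = Fin.all? λ j → (n ≤? k + toℕ j) →-dec (ne π j ≤? m)

  -- One of the last m + 1 positions has at most m positions to its right.
  lightEnd-short : ∀ {n} (π : Word n) {k} → k ≤ suc m → LightEnd π k
  lightEnd-short {n} π {k} k≤ j n≤ = ℕ.≤-trans (ne-bound π j) (ℕ.m≤n+o⇒m∸n≤o n (suc (toℕ j)) (begin
    n                    ≤⟨ n≤ ⟩
    k + toℕ j            ≤⟨ ℕ.+-monoˡ-≤ (toℕ j) k≤ ⟩
    suc (m + toℕ j)      ≡⟨ cong suc (ℕ.+-comm m (toℕ j)) ⟩
    suc (toℕ j + m)      ∎))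
    where open ℕ.≤-Reasoning

  -- Characterising `s` by maximality, not by the last heavy position, includes the all-light word
  -- (`s ≡ n`) without a separate case.
  record State {n} (π : Word n) (s : ℕ) : Set where
    field
      bound   : s ≤ n
      light   : LightEnd π s
      maximal : ∀ k → k ≤ n → LightEnd π k → k ≤ s
  open State public

  state-unique : ∀ {n} {π : Word n} {s t} → State π s → State π t → s ≡ t
  state-unique S T = ℕ.≤-antisym (maximal T _ (bound S) (light S)) (maximal S _ (bound T) (light T))

  abstract
    findState : ∀ {n} (π : Word n) → ∃ (State π)
    findState {n} π = search n ℕ.≤-refl λ k k≤n _ → k≤n
      where
      search : ∀ s → s ≤ n → (∀ k → k ≤ n → LightEnd π k → k ≤ s) → ∃ (State π)
      search zero    s≤n max = 0 , record { bound = s≤n ; light = lightEnd-short π z≤n ; maximal = max }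
      search (suc s) s≤n max with lightEnd? π (suc s)
      ... | yes end = suc s , record { bound = s≤n ; light = end ; maximal = max }
      ... | no ¬end = search s (ℕ.<⇒≤ s≤n) λ k k≤n end →
        s≤s⁻¹ (ℕ.≤∧≢⇒< (max k k≤n end) λ { refl → ¬end end })

  state : ∀ {n} → Word n → ℕ
  state π = proj₁ (findState π)

  state-correct : ∀ {n} (π : Word n) → State π (state π)
  state-correct π = proj₂ (findState π)

  state-≡ : ∀ {n} {π : Word n} {s} → State π s → state π ≡ s
  state-≡ S = state-unique (state-correct _) S

  state-≥ : ∀ {n} (π : Word n) {k} → k ≤ n → k ≤ suc m → k ≤ state π
  state-≥ π k≤n k≤ = maximal (state-correct π) _ k≤n (lightEnd-short π k≤)

  state-short : ∀ {n} (π : Word n) → n ≤ suc m → state π ≡ n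
  state-short π n≤ = ℕ.≤-antisym (bound (state-correct π)) (state-≥ π ℕ.≤-refl n≤)

  good-short : ∀ {n} (π : Word n) → n ≤ suc m → Good π
  good-short π n≤ i j _ _ = lightEnd-short π n≤ j (ℕ.m≤m+n _ (toℕ j))

  all-light : ∀ {n} {π : Word n} → state π ≡ n → ∀ j → Light π j
  all-light {n} {π} eq j = light (state-correct π) j (ℕ.≤-trans (ℕ.≤-reflexive (sym eq)) (ℕ.m≤m+n _ (toℕ j)))

  good-light : ∀ {n} {π : Word n} → state π ≡ n → Good π
  good-light eq i j _ _ = all-light eq j

  module _ {n} (π : Word n) where
    addFixed-light : ∀ {a} → Light π a → Light (addFixed π) (suc a)
    addFixed-light {a} = subst (_≤ m) (sym (ne-addFixed π a))

    addFixed-good⁺ : state π ≡ n → Good (addFixed π)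
    addFixed-good⁺ eq i (suc j) _ _ = addFixed-light (all-light eq j)

    -- The new fixed point is south-west of every old point, so all of these have to be light.
    addFixed-good⁻ : Good (addFixed π) → state π ≡ n
    addFixed-good⁻ good = ℕ.≤-antisym (bound (state-correct π)) (maximal (state-correct π) n ℕ.≤-refl λ j _ →
      subst (_≤ m) (ne-addFixed π j)
        (good zero (suc j) (s≤s z≤n) (subst (λ z → 0 < toℕ z) (sym (lookup-addFixed π j)) (s≤s z≤n))))

    -- All `n` old points are north-east of the new one. For `m < n` it is heavy, and as it stands
    -- first, the `n` light positions behind it form the end.
    state-addFixed : m < n → state π ≡ n → state (addFixed π) ≡ n
    state-addFixed m<n eq = state-≡ record { bound = ℕ.n≤1+n n ; light = end ; maximal = max }
      where
      end : LightEnd (addFixed π) n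
      end zero    n< = contradiction (subst (suc n ≤_) (ℕ.+-identityʳ n) n<) (ℕ.<-irrefl refl)
      end (suc j) _  = addFixed-light (all-light eq j)
      max : ∀ k → k ≤ suc n → LightEnd (addFixed π) k → k ≤ n
      max k k≤ kend with k ℕ.≟ suc n
      ... | no  k≢   = s≤s⁻¹ (ℕ.≤∧≢⇒< k≤ k≢)
      ... | yes refl = contradiction
        (subst (_≤ m) (ne-addFixed-zero π) (kend zero (ℕ.m≤m+n _ 0))) (ℕ.<⇒≱ m<n)

  module _ {n} (v : Fin (suc n)) (π : Word n) (inv : Involutive π) where
    private
      π′ = addSwap v π
      t = n ∸ toℕ v
      s = state π

      v≤n : toℕ v ≤ n
      v≤n = s≤s⁻¹ (Fin.toℕ<n v)

      t+v : t + toℕ v ≡ n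
      t+v = ℕ.m∸n+n≡m v≤n

      light⁺ : ∀ {a} → Light π a → Light π′ (suc (punchIn v a))
      light⁺ {a} = subst (_≤ m) (sym (ne-addSwap v π a))

      light⁻ : ∀ {a} → Light π′ (suc (punchIn v a)) → Light π a
      light⁻ {a} = subst (_≤ m) (ne-addSwap v π a)

    -- The point at `suc v` with value zero is south-west of each of the last `t` old points, so
    -- these have to be light.
    addSwap-good⁻ : Good π′ → Good π × t ≤ s
    addSwap-good⁻ good = old , maximal (state-correct π) t (ℕ.m∸n≤m n (toℕ v)) end
      where
      old : Good π
      old i j i<j πi<πj = light⁻ (good (suc (punchIn v i)) (suc (punchIn v j)) (s≤s (punchIn-mono-< v i<j))
        (subst₂ Fin._<_ (sym (lookup-addSwap v π i)) (sym (lookup-addSwap v π j)) (s≤s (punchIn-mono-< v πi<πj))))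
      end : LightEnd π t
      end j n≤ = light⁻ (good (suc v) (suc (punchIn v j))
        (s≤s (<punchIn v j (ℕ.+-cancelˡ-≤ t (toℕ v) (toℕ j) (ℕ.≤-trans (ℕ.≤-reflexive t+v) n≤))))
        (subst₂ Fin._<_ (sym (lookup-addSwap-self v π)) (sym (lookup-addSwap v π j)) (s≤s z≤n)))

    module _ (t≤s : t ≤ s) where
      private
        v≤⇒light : ∀ b → toℕ v ≤ toℕ b → Light π b
        v≤⇒light b v≤b = light (state-correct π) b (ℕ.≤-trans (ℕ.≤-reflexive (sym t+v)) (ℕ.+-mono-≤ t≤s v≤b))

      addSwap-good⁺ : Good π → Good π′
      addSwap-good⁺ good i (suc j) i<j πi<πj with punchView v j
      ... | itself = contradiction (subst (lookup π′ i Fin.<_) (lookup-addSwap-self v π) πi<πj) ℕ.n≮0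
      -- Position `zero` has value `suc v`, so the old value at `b` is at least `v`. Lightness is
      -- known for positions from `v` on; `ne-symmetric` carries it over to values from `v` on.
      addSwap-good⁺ good zero (suc _) i<j πi<πj | other b =
        light⁺ (subst (_≤ m) (ne-symmetric π inv b)
          (v≤⇒light (lookup π b) (<punchIn⁻ v (lookup π b) (s≤s⁻¹ (subst (lookup π′ zero Fin.<_) (lookup-addSwap v π b) πi<πj)))))
      addSwap-good⁺ good (suc i) (suc _) i<j πi<πj | other b with punchView v i
      ... | itself  = light⁺ (v≤⇒light b (<punchIn⁻ v b (s≤s⁻¹ i<j)))
      ... | other a = light⁺ (good a b (punchIn-cancel-< v (s≤s⁻¹ i<j))
        (punchIn-cancel-< v (s≤s⁻¹ (subst₂ Fin._<_ (lookup-addSwap v π a) (lookup-addSwap v π b) πi<πj))))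

      -- The old positions from `v` on are light and the inserted one is heavy: it is the last heavy
      -- position, with `t` positions after it.
      state-addSwap-heavy : m < t → state π′ ≡ t
      state-addSwap-heavy m<t = state-≡ record
        { bound = ℕ.≤-trans (ℕ.m∸n≤m n (toℕ v)) (ℕ.m≤n+m n 2) ; light = end ; maximal = max }
        where
        beyond : ∀ j → suc (suc n) ≤ t + toℕ j → suc (suc (toℕ v)) ≤ toℕ j
        beyond j n≤ = ℕ.+-cancelˡ-≤ t _ _ (ℕ.≤-trans (ℕ.≤-reflexive (trans (ℕ.+-suc t _)
          (cong suc (trans (ℕ.+-suc t _) (cong suc t+v))))) n≤)
        end : LightEnd π′ t
        end j n≤ with beyond j n≤
        end (suc j) n≤ | s≤s v<j with punchView v j
        ... | itself  = contradiction v<j (ℕ.<-irrefl refl)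
        ... | other b = light⁺ (v≤⇒light b (<punchIn⁻ v b v<j))
        max : ∀ k → k ≤ suc (suc n) → LightEnd π′ k → k ≤ t
        max k _ kend with k ≤? t
        ... | yes k≤t = k≤t
        ... | no  k≰t = contradiction
          (subst (_≤ m) (ne-addSwap-self v π) (kend (suc v) (begin
            suc (suc n)             ≡⟨ cong (λ z → suc (suc z)) t+v ⟨
            suc (suc (t + toℕ v))   ≡⟨ cong suc (ℕ.+-suc t (toℕ v)) ⟨
            suc t + suc (toℕ v)     ≤⟨ ℕ.+-monoˡ-≤ (suc (toℕ v)) (ℕ.≰⇒> k≰t) ⟩
            k + suc (toℕ v)         ∎)))
          (ℕ.<⇒≱ m<t)
          where open ℕ.≤-Reasoning

      module _ (t≤m : t ≤ m) where
        private
          self-light : Light π′ (suc v)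
          self-light = subst (_≤ m) (sym (ne-addSwap-self v π)) t≤m

        state-addSwap-all : s ≡ n → state π′ ≡ suc (suc n)
        state-addSwap-all s≡n = state-≡ record { bound = ℕ.≤-refl ; light = end ; maximal = λ k k≤ _ → k≤ }
          where
          end : LightEnd π′ (suc (suc n))
          end zero    _ = subst (_≤ m) (sym (ne-addSwap-zero v π inv)) t≤m
          end (suc j) _ with punchView v j
          ... | itself  = self-light
          ... | other b = light⁺ (all-light s≡n b)

        -- The last heavy old position precedes `v`, so the light position `suc v` lengthens the
        -- light end by one, while the new first position stays outside that end.
        state-addSwap-light : s < n → state π′ ≡ suc s
        state-addSwap-light s<n = state-≡ record
          { bound = ℕ.≤-trans s<n (ℕ.m≤n+m n 2) ; light = end ; maximal = max }
          where
          end : LightEnd π′ (suc s)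
          end zero    n≤ = contradiction
            (ℕ.≤-trans (s≤s⁻¹ n≤) (ℕ.≤-reflexive (ℕ.+-identityʳ s))) (ℕ.<⇒≱ (ℕ.<-trans s<n (ℕ.n<1+n n)))
          end (suc j) n≤ with punchView v j
          ... | itself  = self-light
          ... | other b with toℕ v ≤? toℕ b
          ...   | yes v≤b = light⁺ (v≤⇒light b v≤b)
          ...   | no  v≰b = light⁺ (light (state-correct π) b (subst (λ z → n ≤ s + z) (punchIn-< v b (ℕ.≰⇒> v≰b))
            (s≤s⁻¹ (subst (suc n ≤_) (ℕ.+-suc s _) (s≤s⁻¹ n≤)))))
          max : ∀ k → k ≤ suc (suc n) → LightEnd π′ k → k ≤ suc s
          max zero    _  _    = z≤n
          max (suc k) k≤ kend with k ≤? n
          ... | yes k≤n = s≤s (maximal (state-correct π) k k≤n λ b n≤ → light⁻ (kend (suc (punchIn v b)) (s≤s (begin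
            suc n                          ≤⟨ s≤s n≤ ⟩
            suc (k + toℕ b)                ≤⟨ s≤s (ℕ.+-monoʳ-≤ k (≤punchIn v b)) ⟩
            suc (k + toℕ (punchIn v b))    ≡⟨ ℕ.+-suc k _ ⟨
            k + suc (toℕ (punchIn v b))    ∎))))
            where open ℕ.≤-Reasoning
          -- An end this long would contain every old position, and all old points would be light,
          -- against `s < n`.
          ... | no  k≰n = contradiction
            (maximal (state-correct π) n ℕ.≤-refl λ b _ → light⁻ (kend (suc (punchIn v b))
              (s≤s (ℕ.≤-trans (ℕ.≰⇒> k≰n) (ℕ.m≤m+n k _)))))
            (ℕ.<⇒≱ s<n)

-- Avoiding `𝒜 k` as a condition on heavy points

module Avoidance (m : ℕ) where
  open import Data.Nat using (zero; suc; _≤_; _<_; _≤?_; z≤n; s≤s; s≤s⁻¹; z<s)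
  import Data.Nat.Properties as ℕ
  open import Data.Fin as Fin using (Fin; zero; suc; toℕ; fromℕ<)
  import Data.Fin.Properties as Fin
  open import Data.List.Membership.Propositional using (_∈_)
  open import Data.List.Membership.Propositional.Properties using (∈-filter⁺; ∈-filter⁻)
  import Data.List.Relation.Unary.All as All
  open import Data.Product using (_×_; _,_; proj₁; proj₂)
  open import Data.Vec using (Vec; lookup; tabulate)
  open import Data.Vec.Properties using (lookup∘tabulate)
  open import Function using (mk⇔; Equivalence)
  open import Relation.Binary.Definitions using (tri<; tri≈; tri>)
  open import Relation.Binary.PropositionalEquality
  open import Relation.Nullary using (¬_; Dec; yes; no; contradiction)
  open import Relation.Nullary.Decidable using (_→-dec_)
  open Insertion
  open Counting
  open Light
  open States m

  k : ℕ
  k = suc (suc (suc m))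

  StartsWith12 : Word k → Set
  StartsWith12 σ = ∀ i → toℕ i < 2 → lookup σ i ≡ i

  startsWith12? : ∀ σ → Dec (StartsWith12 σ)
  startsWith12? σ = Fin.all? λ i → (toℕ i ℕ.<? 2) →-dec (lookup σ i Fin.≟ i)

  ∈-𝒜⁺ : ∀ σ → IsPermutation σ → StartsWith12 σ → σ ∈ 𝒜 k
  ∈-𝒜⁺ σ perm start = ∈-filter⁺ startsWith12? (∈-filter⁺ isPermutation? (∈-vectors σ) perm) start

  ∈-𝒜⁻ : ∀ {σ} → σ ∈ 𝒜 k → IsPermutation σ × StartsWith12 σ
  ∈-𝒜⁻ σ∈ =
    let σ∈𝔖 , start = ∈-filter⁻ startsWith12? {xs = 𝔖 k} σ∈ in
    proj₂ (∈-filter⁻ isPermutation? {xs = vectors k k} σ∈𝔖) , start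

  private
    pattern #0 = zero
    pattern #1 = suc zero
    pattern #2+ a = suc (suc a)

  -- In an occurrence the second entry has the first to its south-west and the other k - 2 = m + 1
  -- to its north-east, so it is heavy.
  good⇒avoids : ∀ {n} (π : Word n) → Good π → Avoids (𝒜 k) π
  good⇒avoids {n} π good = All.tabulate λ {σ} σ∈ (ι , incr , iso) → absurd σ ι (∈-𝒜⁻ σ∈) incr iso
    where
    absurd : ∀ σ (ι : Vec (Fin n) k) → IsPermutation σ × StartsWith12 σ →
      (∀ a b → a Fin.< b → lookup ι a Fin.< lookup ι b) →
      ¬ (∀ a b → lookup σ a Fin.< lookup σ b ⇔ lookup π (lookup ι a) Fin.< lookup π (lookup ι b))
    absurd σ ι ((inj , _) , start) incr iso = ℕ.<⇒≱ heavy (good (lookup ι #0) (lookup ι #1) (incr #0 #1 z<s) σ₀₁)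
      where
      σ₀₁ : lookup π (lookup ι #0) Fin.< lookup π (lookup ι #1)
      σ₀₁ = Equivalence.to (iso #0 #1) (subst₂ Fin._<_ (sym (start #0 z<s)) (sym (start #1 (s≤s z<s))) z<s)
      σ₁< : ∀ a → lookup σ #1 Fin.< lookup σ (#2+ a)
      σ₁< a with lookup σ (#2+ a) in eq
      ... | #0    with () ← inj {#2+ a} {#0} (trans eq (sym (start #0 z<s)))
      ... | #1    with () ← inj {#2+ a} {#1} (trans eq (sym (start #1 (s≤s z<s))))
      ... | #2+ b = subst (Fin._< #2+ b) (sym (start #1 (s≤s z<s))) (s≤s z<s)
      heavy : m < ne π (lookup ι #1)
      heavy = count-injection (northEast? π (lookup ι #1)) (λ a → lookup ι (#2+ a)) ι-inj
        λ a → incr #1 (#2+ a) (s≤s z<s) , Equivalence.to (iso #1 (#2+ a)) (σ₁< a)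
        where
        ι-inj : ∀ {a b} → lookup ι (#2+ a) ≡ lookup ι (#2+ b) → a ≡ b
        ι-inj {a} {b} eq with Fin.<-cmp a b
        ... | tri< a<b _ _ = contradiction eq (Fin.<⇒≢ (incr (#2+ a) (#2+ b) (s≤s (s≤s a<b))))
        ... | tri≈ _ a≡b _ = a≡b
        ... | tri> _ _ b<a = contradiction (sym eq) (Fin.<⇒≢ (incr (#2+ b) (#2+ a) (s≤s (s≤s b<a))))

  module Standardize {n q} (w : Fin q → Fin n) (w-inj : ∀ {a b} → w a ≡ w b → a ≡ b) where
    below : Fin q → Fin q → ℕ
    below a b = indicator (w b Fin.<? w a)

    rank : Fin q → ℕ
    rank a = sum (below a)

    rank-mono : ∀ {a b} → w a Fin.< w b → rank a < rank b
    rank-mono {a} {b} lt = sum-mono-<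
      (λ c → indicator-mono (w c Fin.<? w a) (w c Fin.<? w b) λ c<a → ℕ.<-trans c<a lt) a
      (subst₂ _<_ (sym (indicator-no (w a Fin.<? w a) (ℕ.<-irrefl refl))) (sym (indicator-yes (w a Fin.<? w b) lt)) z<s)

    rank-cancel : ∀ {a b} → rank a < rank b → w a Fin.< w b
    rank-cancel {a} {b} lt with Fin.<-cmp (w a) (w b)
    ... | tri< a<b _ _ = a<b
    ... | tri≈ _ a≡b _ = contradiction lt (ℕ.<-irrefl (cong rank (w-inj a≡b)))
    ... | tri> _ _ b<a = contradiction lt (ℕ.<⇒≯ (rank-mono b<a))

    rank-injective : ∀ {a b} → rank a ≡ rank b → a ≡ b
    rank-injective {a} {b} eq with Fin.<-cmp (w a) (w b)
    ... | tri< a<b _ _ = contradiction eq (ℕ.<⇒≢ (rank-mono a<b))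
    ... | tri≈ _ a≡b _ = w-inj a≡b
    ... | tri> _ _ b<a = contradiction (sym eq) (ℕ.<⇒≢ (rank-mono b<a))

    rank< : ∀ a → rank a < q
    rank< a = subst (rank a <_) (sum-one {q} {λ _ → 1} λ _ → refl)
      (sum-mono-< (λ c → indicator≤1 (w c Fin.<? w a)) a
        (subst (_< 1) (sym (indicator-no (w a Fin.<? w a) (ℕ.<-irrefl refl))) z<s))
      where
      indicator≤1 : ∀ {P : Set} (P? : Dec P) → indicator P? ≤ 1
      indicator≤1 (yes _) = ℕ.≤-refl
      indicator≤1 (no _)  = z≤n

    τ : Word q
    τ = tabulate λ a → fromℕ< (rank< a)

    toℕ-τ : ∀ a → toℕ (lookup τ a) ≡ rank a
    toℕ-τ a = trans (cong toℕ (lookup∘tabulate (λ a → fromℕ< (rank< a)) a)) (Fin.toℕ-fromℕ< (rank< a))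

    τ-iso : ∀ a b → lookup τ a Fin.< lookup τ b ⇔ w a Fin.< w b
    τ-iso a b = mk⇔ (λ lt → rank-cancel (subst₂ _<_ (toℕ-τ a) (toℕ-τ b) lt))
                    (λ lt → subst₂ _<_ (sym (toℕ-τ a)) (sym (toℕ-τ b)) (rank-mono lt))

    τ-permutation : IsPermutation τ
    τ-permutation = τ-inj , λ y →
      let i , eq = injective⇒surjective (lookup τ) τ-inj y in i , λ z≡i → trans (cong (lookup τ) z≡i) eq
      where
      τ-inj : ∀ {a b} → lookup τ a ≡ lookup τ b → a ≡ b
      τ-inj {a} {b} eq = rank-injective (trans (sym (toℕ-τ a)) (trans (cong toℕ eq) (toℕ-τ b)))

  -- A heavy `j` with `i` to its south-west, together with m + 1 points north-east of `j`, spells a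
  -- pattern that begins with 1 2. Whichever pattern this is, it belongs to `𝒜 k`, so standardising
  -- these values suffices.
  avoids⇒good : ∀ {n} (π : Word n) → Involutive π → Avoids (𝒜 k) π → Good π
  avoids⇒good {n} π inv avoids i j i<j πi<πj with ne π j ≤? m
  ... | yes light = light
  ... | no  heavy = contradiction contains (All.lookup avoids (∈-𝒜⁺ τ τ-permutation start))
    where
    above = count-increasing (suc m) (northEast? π j) (ℕ.≰⇒> heavy)
    g : Fin (suc m) → Fin n
    g = proj₁ above
    g-ne : ∀ a → j Fin.< g a × lookup π j Fin.< lookup π (g a)
    g-ne = proj₂ (proj₂ above)

    e : Fin k → Fin n
    e #0      = i
    e #1      = j
    e (#2+ a) = g a

    e-mono : ∀ a b → a Fin.< b → e a Fin.< e b
    e-mono #0      #1      _   = i<j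
    e-mono #0      (#2+ b) _   = ℕ.<-trans i<j (proj₁ (g-ne b))
    e-mono #1      #1      lt  = contradiction lt (ℕ.<-irrefl refl)
    e-mono #1      (#2+ b) _   = proj₁ (g-ne b)
    e-mono (#2+ a) #1      lt  = contradiction (s≤s⁻¹ lt) ℕ.n≮0
    e-mono (#2+ a) (#2+ b) lt  = proj₁ (proj₂ above) (s≤s⁻¹ (s≤s⁻¹ lt))

    w : Fin k → Fin n
    w a = lookup π (e a)

    w-inj : ∀ {a b} → w a ≡ w b → a ≡ b
    w-inj {a} {b} eq with Fin.<-cmp a b
    ... | tri< a<b _ _ = contradiction (involutive-injective π inv eq) (Fin.<⇒≢ (e-mono a b a<b))
    ... | tri≈ _ a≡b _ = a≡b
    ... | tri> _ _ b<a = contradiction (involutive-injective π inv (sym eq)) (Fin.<⇒≢ (e-mono b a b<a))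

    open Standardize w w-inj

    ¬<w₀ : ∀ b → ¬ (w b Fin.< w #0)
    ¬<w₀ #0      = ℕ.<-irrefl refl
    ¬<w₀ #1      = ℕ.<⇒≯ πi<πj
    ¬<w₀ (#2+ b) = ℕ.<⇒≯ (ℕ.<-trans πi<πj (proj₂ (g-ne b)))

    ¬<w₁ : ∀ b → ¬ (w (suc b) Fin.< w #1)
    ¬<w₁ #0      = ℕ.<-irrefl refl
    ¬<w₁ (suc b) = ℕ.<⇒≯ (proj₂ (g-ne b))

    start : StartsWith12 τ
    start #0 _ = Fin.toℕ-injective (trans (toℕ-τ #0)
      (sum-zero {k} λ b → indicator-no (w b Fin.<? w #0) (¬<w₀ b)))
    start #1 _ = Fin.toℕ-injective (trans (toℕ-τ #1) (cong₂ Data.Nat._+_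
      (indicator-yes (w #0 Fin.<? w #1) πi<πj)
      (sum-zero {suc (suc m)} λ b → indicator-no (w (suc b) Fin.<? w #1) (¬<w₁ b))))
    start (#2+ _) (s≤s (s≤s ()))

    contains : Contains π τ
    contains = tabulate e ,
      (λ a b lt → subst₂ Fin._<_ (sym (lookup∘tabulate e a)) (sym (lookup∘tabulate e b)) (e-mono a b lt)) ,
      (λ a b → subst₂ (λ s t → lookup τ a Fin.< lookup τ b ⇔ lookup π s Fin.< lookup π t)
        (sym (lookup∘tabulate e a)) (sym (lookup∘tabulate e b)) (τ-iso a b))

  avoids⇔good : ∀ {n} (π : Word n) → Involutive π → Avoids (𝒜 k) π ⇔ Good π
  avoids⇔good π inv = mk⇔ (avoids⇒good π inv) (good⇒avoids π)

-- Fixed points under insertion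

module FixedPoints where
  open import Data.Nat using (suc)
  open import Data.Fin using (Fin; zero; suc; punchIn)
  import Data.Fin.Properties as Fin
  open import Data.List using (filter; length; tabulate)
  open import Data.Vec using (lookup)
  open import Function using (_∘_; mk⇔)
  open import Relation.Binary.PropositionalEquality
  open import Relation.Nullary using (yes; no)
  open import Relation.Unary using (Decidable)
  open Insertion
  open Counting
  open Light using (sum-addSwap)

  length-filter-tabulate : ∀ {n} {A : Set} {P : A → Set} (P? : Decidable P) (f : Fin n → A) →
    length (filter P? (tabulate f)) ≡ sum (λ i → indicator (P? (f i)))
  length-filter-tabulate {ℕ.zero}  P? f = refl
  length-filter-tabulate {suc n} P? f with P? (f zero)
  ... | yes _ = cong suc (length-filter-tabulate P? (f ∘ suc))
  ... | no _  = length-filter-tabulate P? (f ∘ suc)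

  fixed? : ∀ {n} (π : Word n) → Decidable (λ i → lookup π i ≡ i)
  fixed? π i = lookup π i Fin.≟ i

  fix-sum : ∀ {n} (π : Word n) → fix π ≡ sum (λ i → indicator (fixed? π i))
  fix-sum π = length-filter-tabulate (fixed? π) (λ i → i)

  fix-addFixed : ∀ {n} (π : Word n) → fix (addFixed π) ≡ suc (fix π)
  fix-addFixed {n} π = trans (fix-sum (addFixed π)) (cong suc (trans
    (sum-cong-≗ {n} λ i → indicator-cong (fixed? (addFixed π) (suc i)) (fixed? π i)
      (mk⇔ (λ eq → Fin.suc-injective (trans (sym (lookup-addFixed π i)) eq))
           (λ eq → trans (lookup-addFixed π i) (cong suc eq))))
    (sym (fix-sum π))))

  fix-addSwap : ∀ {n} v (π : Word n) → fix (addSwap v π) ≡ fix π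
  fix-addSwap {n} v π = trans (fix-sum π′) (trans
    (sum-addSwap v (λ i → indicator (fixed? π′ i))
      (indicator-no (fixed? π′ zero) λ ())
      (indicator-no (fixed? π′ (suc v)) λ eq → 0≢ (trans (sym (lookup-addSwap-self v π)) eq)))
    (trans (sum-cong-≗ {n} λ i → indicator-cong (fixed? π′ (suc (punchIn v i))) (fixed? π i)
      (mk⇔ (λ eq → Fin.punchIn-injective v _ _ (Fin.suc-injective (trans (sym (lookup-addSwap v π i)) eq)))
           (λ eq → trans (lookup-addSwap v π i) (cong (suc ∘ punchIn v) eq))))
    (sym (fix-sum π))))
    where
    π′ = addSwap v π
    0≢ : zero ≢ suc v
    0≢ ()

-- Sums over lists

module ListSums {a ℓ} (R : CommutativeRing a ℓ) where
  open import Data.List using (List; []; _∷_; _++_; map; filter; cartesianProductWith)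
  open import Data.List.Relation.Binary.Permutation.Propositional using (_↭_; refl; prep; swap; trans)
  open import Data.List.Relation.Unary.All using (All; []; _∷_)
  open import Relation.Nullary using (¬_; Dec; yes; no; contradiction)
  open import Relation.Unary using (Decidable)
  open import Function using (_⇔_; Equivalence)
  open CommutativeRing R hiding (refl; trans)
  private module ≈ = CommutativeRing R
  open import Relation.Binary.Reasoning.Setoid setoid
  open import Algebra.Solver.CommutativeMonoid +-commutativeMonoid using (solve; _⊕_; _⊜_)

  private variable
    A B D : Set
    xs ys : List A

  Σᴸ : (A → Carrier) → List A → Carrier
  Σᴸ f []       = 0#
  Σᴸ f (x ∷ xs) = f x + Σᴸ f xs

  Σᴸ-cong : ∀ {P : A → Set} {f g} → (∀ {x} → P x → f x ≈ g x) → All P xs → Σᴸ f xs ≈ Σᴸ g xs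
  Σᴸ-cong eq []         = ≈.refl
  Σᴸ-cong eq (px ∷ pxs) = +-cong (eq px) (Σᴸ-cong eq pxs)

  Σᴸ-++ : ∀ (f : A → Carrier) xs ys → Σᴸ f (xs ++ ys) ≈ Σᴸ f xs + Σᴸ f ys
  Σᴸ-++ f []       ys = sym (+-identityˡ _)
  Σᴸ-++ f (x ∷ xs) ys = ≈.trans (+-congˡ (Σᴸ-++ f xs ys)) (sym (+-assoc _ _ _))

  Σᴸ-map : ∀ (f : B → Carrier) (g : A → B) xs → Σᴸ f (map g xs) ≈ Σᴸ (λ x → f (g x)) xs
  Σᴸ-map f g []       = ≈.refl
  Σᴸ-map f g (x ∷ xs) = +-congˡ (Σᴸ-map f g xs)

  Σᴸ-0 : ∀ (xs : List A) → Σᴸ (λ _ → 0#) xs ≈ 0#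
  Σᴸ-0 []       = ≈.refl
  Σᴸ-0 (x ∷ xs) = ≈.trans (+-identityˡ _) (Σᴸ-0 xs)

  Σᴸ-+ : ∀ (f g : A → Carrier) xs → Σᴸ (λ x → f x + g x) xs ≈ Σᴸ f xs + Σᴸ g xs
  Σᴸ-+ f g []       = sym (+-identityˡ _)
  Σᴸ-+ f g (x ∷ xs) = ≈.trans (+-congˡ (Σᴸ-+ f g xs))
    (solve 4 (λ a b c d → (a ⊕ b) ⊕ (c ⊕ d) ⊜ (a ⊕ c) ⊕ (b ⊕ d)) ≈.refl _ _ _ _)

  Σᴸ-* : ∀ c (f : A → Carrier) xs → Σᴸ (λ x → c * f x) xs ≈ c * Σᴸ f xs
  Σᴸ-* c f []       = sym (zeroʳ c)
  Σᴸ-* c f (x ∷ xs) = ≈.trans (+-congˡ (Σᴸ-* c f xs)) (sym (distribˡ c _ _))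

  Σᴸ-cartesianProductWith : ∀ (h : D → Carrier) (f : A → B → D) xs ys →
    Σᴸ h (cartesianProductWith f xs ys) ≈ Σᴸ (λ y → Σᴸ (λ x → h (f x y)) xs) ys
  Σᴸ-cartesianProductWith h f []       ys = sym (Σᴸ-0 ys)
  Σᴸ-cartesianProductWith h f (x ∷ xs) ys = begin
    Σᴸ h (map (f x) ys ++ cartesianProductWith f xs ys)
      ≈⟨ Σᴸ-++ h (map (f x) ys) _ ⟩
    Σᴸ h (map (f x) ys) + Σᴸ h (cartesianProductWith f xs ys)
      ≈⟨ +-cong (Σᴸ-map h (f x) ys) (Σᴸ-cartesianProductWith h f xs ys) ⟩
    Σᴸ (λ y → h (f x y)) ys + Σᴸ (λ y → Σᴸ (λ x → h (f x y)) xs) ys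
      ≈⟨ Σᴸ-+ _ _ ys ⟨
    Σᴸ (λ y → Σᴸ (λ x → h (f x y)) (x ∷ xs)) ys ∎

  Σᴸ-↭ : ∀ (f : A → Carrier) → xs ↭ ys → Σᴸ f xs ≈ Σᴸ f ys
  Σᴸ-↭ f refl         = ≈.refl
  Σᴸ-↭ f (prep x p)   = +-congˡ (Σᴸ-↭ f p)
  Σᴸ-↭ f (swap x y p) = ≈.trans (+-congˡ (+-congˡ (Σᴸ-↭ f p)))
    (solve 3 (λ a b c → a ⊕ (b ⊕ c) ⊜ b ⊕ (a ⊕ c)) ≈.refl _ _ _)
  Σᴸ-↭ f (trans p q)  = ≈.trans (Σᴸ-↭ f p) (Σᴸ-↭ f q)

  when : ∀ {P : Set} → Dec P → Carrier → Carrier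
  when (yes _) c = c
  when (no _)  c = 0#

  when-yes : ∀ {P : Set} (P? : Dec P) {c} → P → when P? c ≈ c
  when-yes (yes _) p = ≈.refl
  when-yes (no ¬p) p = contradiction p ¬p

  when-no : ∀ {P : Set} (P? : Dec P) {c} → ¬ P → when P? c ≈ 0#
  when-no (yes p) ¬p = contradiction p ¬p
  when-no (no _)  ¬p = ≈.refl

  when-cong : ∀ {P Q : Set} (P? : Dec P) (Q? : Dec Q) {c d} → P ⇔ Q → (P → c ≈ d) → when P? c ≈ when Q? d
  when-cong (yes p) (yes _) e eq = eq p
  when-cong (yes p) (no ¬q) e eq = contradiction (Equivalence.to e p) ¬q
  when-cong (no ¬p) (yes q) e eq = contradiction (Equivalence.from e q) ¬p
  when-cong (no _)  (no _)  e eq = ≈.refl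

  Σᴸ-filter : ∀ {P : A → Set} (P? : Decidable P) f xs → Σᴸ f (filter P? xs) ≈ Σᴸ (λ x → when (P? x) (f x)) xs
  Σᴸ-filter P? f []       = ≈.refl
  Σᴸ-filter P? f (x ∷ xs) with P? x
  ... | yes _ = +-congˡ (Σᴸ-filter P? f xs)
  ... | no  _ = ≈.trans (Σᴸ-filter P? f xs) (sym (+-identityˡ _))

-- Generating functions of subtrees

module Tree {a ℓ} (R : CommutativeRing a ℓ)
  (φ : ℚ.+-*-rawRing -Raw-AlmostCommutative⟶ fromCommutativeRing R)
  (m : ℕ) {k : ℕ} (T : List (Word k))
  (avoids⇔good : ∀ {n} (π : Word n) → Insertion.Involutive π → Avoids T π ⇔ States.Good m π)
  (x p u μ c⁻¹ : CommutativeRing.Carrier R) where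
  open import Data.Nat as ℕ using (zero; suc; _∸_; _≤_; _<_; _≤?_; s≤s)
  import Data.Nat.Properties as ℕ
  open import Data.Fin using (Fin; toℕ)
  open import Data.List using (allFin; tabulate; cartesianProductWith; map)
  import Data.List.Relation.Unary.All as All
  open import Data.Product using (proj₁; proj₂)
  open import Function using (_∘_; mk⇔)
  import Relation.Binary.PropositionalEquality as ≡
  open ≡ using (_≡_)
  open import Relation.Nullary using (Dec; yes; no; contradiction)
  open CommutativeRing R
  open RationalSolver R φ using (solve; _:+_; _:*_; _:=_; con)
  open import Relation.Binary.Reasoning.Setoid setoid
  open import Algebra.Properties.Semiring.Exp semiring using (_^_)
  open Kernel R φ
  open Params m x p u μ c⁻¹
  open Insertion
  open States m
  open ListSums R
  open FixedPoints

  gf : ∀ {n} → List (Word n) → Carrier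
  gf = Σᴸ (λ π → p ^ fix π)

  avoidingGF involutionGF : ℕ → Carrier
  avoidingGF n = gf (ℐ-avoiding T n)
  involutionGF n = gf (ℐ n)

  avoidingGF-good : ∀ n → avoidingGF n ≈ Σᴸ (λ π → when (good? π) (p ^ fix π)) (involutions n)
  avoidingGF-good n = begin
    Σᴸ (λ π → p ^ fix π) (ℐ-avoiding T n)
      ≈⟨ Σᴸ-filter (avoids? T) (λ π → p ^ fix π) (ℐ n) ⟩
    Σᴸ (λ π → when (avoids? T π) (p ^ fix π)) (ℐ n)
      ≈⟨ Σᴸ-↭ (λ π → when (avoids? T π) (p ^ fix π)) (ℐ↭involutions n) ⟩
    Σᴸ (λ π → when (avoids? T π) (p ^ fix π)) (involutions n)
      ≈⟨ Σᴸ-cong (λ {π} inv → when-cong (avoids? T π) (good? π)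
           (avoids⇔good π inv) λ _ → refl) (involutions-involutive n) ⟩
    Σᴸ (λ π → when (good? π) (p ^ fix π)) (involutions n) ∎

  involutionGF-involutions : ∀ n → involutionGF n ≈ Σᴸ (λ π → p ^ fix π) (involutions n)
  involutionGF-involutions n = Σᴸ-↭ (λ π → p ^ fix π) (ℐ↭involutions n)

  avoidingGF-short : ∀ n → n ≤ suc m → avoidingGF n ≈ involutionGF n
  avoidingGF-short n n≤ = begin
    avoidingGF n
      ≈⟨ avoidingGF-good n ⟩
    Σᴸ (λ π → when (good? π) (p ^ fix π)) (involutions n)
      ≈⟨ Σᴸ-cong (λ {π} _ → when-yes (good? π) (good-short π n≤)) (involutions-involutive n) ⟩
    Σᴸ (λ π → p ^ fix π) (involutions n)
      ≈⟨ involutionGF-involutions n ⟨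
    involutionGF n ∎

  module _ (roots : Roots) where
    open Equations roots

    -- The generating function of all descendants of a word with n letters and state s.
    descendants : ℕ → ℕ → Carrier
    descendants n s with s ℕ.≟ n
    ... | yes _ = κ * lam ^ (n ∸ suc m)
    ... | no  _ = μ * lam ^ (s ∸ m)

    descendants-all : ∀ {n s} → s ≡ n → descendants n s ≡ κ * lam ^ (n ∸ suc m)
    descendants-all {n} {s} eq with s ℕ.≟ n
    ... | yes _  = ≡.refl
    ... | no neq = contradiction eq neq

    descendants-heavy : ∀ {n s} → s < n → descendants n s ≡ μ * lam ^ (s ∸ m)
    descendants-heavy {n} {s} lt with s ℕ.≟ n
    ... | yes eq = contradiction lt (ℕ.<-irrefl eq)
    ... | no  _  = ≡.refl

    weight : ∀ {n} → Word n → Carrier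
    weight {n} π = when (good? π) (p ^ fix π * descendants n (state π))

    -- The descendants of a swap whose new points are light.
    lightSwap : ℕ → ℕ → Carrier
    lightSwap n s with s ℕ.≟ n
    ... | yes _ = κ * lam ^ suc (n ∸ m)
    ... | no  _ = μ * lam ^ (suc s ∸ m)

    -- Changes the index from the insertion place `v` to the number t = n - v of points above. It
    -- decreases as `v` grows, which is why `Σ≤` adds its largest index first.
    Σᴸ-allFin : ∀ n (h : ℕ → Carrier) → Σᴸ (λ v → h (n ∸ toℕ v)) (allFin (suc n)) ≈ Σ≤ n h
    Σᴸ-allFin n h = trans (go (suc n) (λ v → v)) (rev n)
      where
      sumFin : ∀ q → (Fin q → Carrier) → Carrier
      sumFin zero    f = 0#
      sumFin (suc q) f = f Fin.zero + sumFin q (f ∘ Fin.suc)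
      go : ∀ q (f : Fin q → Fin (suc n)) →
        Σᴸ (λ v → h (n ∸ toℕ v)) (tabulate f) ≈ sumFin q (λ i → h (n ∸ toℕ (f i)))
      go zero    f = refl
      go (suc q) f = +-congˡ (go q (f ∘ Fin.suc))
      rev : ∀ q → sumFin (suc q) (λ i → h (q ∸ toℕ i)) ≈ Σ≤ q h
      rev zero    = +-identityʳ _
      rev (suc q) = +-congˡ (rev q)

    swapTerm : ∀ {n} → Word n → ℕ → Carrier
    swapTerm {n} π t with t ≤? state π
    ... | yes _ = when (good? π) (p ^ fix π * branch (lightSwap n (state π)) t)
    ... | no  _ = 0#

    swapTerm-≤ : ∀ {n} (π : Word n) {t} → t ≤ state π →
      swapTerm π t ≈ when (good? π) (p ^ fix π * branch (lightSwap n (state π)) t)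
    swapTerm-≤ π {t} t≤ with t ≤? state π
    ... | yes _  = refl
    ... | no t≰s = contradiction t≤ t≰s

    swapTerm-> : ∀ {n} (π : Word n) {t} → state π < t → swapTerm π t ≈ 0#
    swapTerm-> π {t} s<t with t ≤? state π
    ... | yes t≤s = contradiction t≤s (ℕ.<⇒≱ s<t)
    ... | no _    = refl

    weight-addSwap : ∀ {n} v (π : Word n) → Involutive π → m ≤ n →
      weight (addSwap v π) ≈ swapTerm π (n ∸ toℕ v)
    weight-addSwap {n} v π inv m≤n with n ∸ toℕ v ≤? state π
    ... | no  t≰s = when-no (good? (addSwap v π)) λ good → t≰s (proj₂ (addSwap-good⁻ v π inv good))
    ... | yes t≤s = when-cong (good? (addSwap v π)) (good? π)
      (mk⇔ (λ good → proj₁ (addSwap-good⁻ v π inv good)) (addSwap-good⁺ v π inv t≤s))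
      λ _ → *-cong (reflexive (≡.cong (p ^_) (fix-addSwap v π))) same
      where
      same : descendants (suc (suc n)) (state (addSwap v π)) ≈ branch (lightSwap n (state π)) (n ∸ toℕ v)
      same with n ∸ toℕ v ≤? m
      ... | no t≰m = reflexive (≡.trans (≡.cong (descendants (suc (suc n))) (state-addSwap-heavy v π inv t≤s (ℕ.≰⇒> t≰m)))
              (descendants-heavy (s≤s (ℕ.m≤n⇒m≤1+n (ℕ.m∸n≤m n (toℕ v))))))
      ... | yes t≤m with state π ℕ.≟ n
      -- The word has n + 2 letters, and (n + 2) - (m + 1) = 1 + (n - m) as `m ≤ n`.
      ...   | yes eq = reflexive (≡.trans (descendants-all (state-addSwap-all v π inv t≤s t≤m eq))
                (≡.cong (λ e → κ * lam ^ e) (ℕ.+-∸-assoc 1 m≤n)))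
      ...   | no neq =
        let s<n = ℕ.≤∧≢⇒< (bound (state-correct π)) neq in
        reflexive (≡.trans (≡.cong (descendants (suc (suc n))) (state-addSwap-light v π inv t≤s t≤m s<n))
          (descendants-heavy (s≤s (ℕ.m≤n⇒m≤1+n s<n))))

    Σ-addSwap : ∀ {n} (π : Word n) → Involutive π → m ≤ n →
      Σᴸ (λ v → weight (addSwap v π)) (allFin (suc n)) ≈
        when (good? π) (p ^ fix π * Σ≤ (state π) (branch (lightSwap n (state π))))
    Σ-addSwap {n} π inv m≤n = begin
      Σᴸ (λ v → weight (addSwap v π)) (allFin (suc n))
        ≈⟨ Σᴸ-cong (λ {v} _ → weight-addSwap v π inv m≤n) (All.universal-U (allFin (suc n))) ⟩
      Σᴸ (λ v → swapTerm π (n ∸ toℕ v)) (allFin (suc n))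
        ≈⟨ Σᴸ-allFin n (swapTerm π) ⟩
      Σ≤ n (swapTerm π)
        ≈⟨ Σ≤-below (state π) n (bound (state-correct π)) (λ t → swapTerm-≤ π) (λ t → swapTerm-> π) ⟩
      Σ≤ (state π) (λ t → when (good? π) (p ^ fix π * branch (lightSwap n (state π)) t))
        ≈⟨ pull (good? π) ⟩
      when (good? π) (p ^ fix π * Σ≤ (state π) (branch (lightSwap n (state π)))) ∎
      where
      Σ≤-* : ∀ q b h → Σ≤ q (λ t → b * h t) ≈ b * Σ≤ q h
      Σ≤-* zero    b h = refl
      Σ≤-* (suc q) b h = trans (+-congˡ (Σ≤-* q b h)) (sym (distribˡ b _ _))
      Σ≤-0 : ∀ q → Σ≤ q (λ _ → 0#) ≈ 0#
      Σ≤-0 zero    = refl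
      Σ≤-0 (suc q) = trans (+-identityˡ _) (Σ≤-0 q)
      pull : (P? : Dec (Good π)) → Σ≤ (state π) (λ t → when P? (p ^ fix π * branch (lightSwap n (state π)) t)) ≈
        when P? (p ^ fix π * Σ≤ (state π) (branch (lightSwap n (state π))))
      pull (yes _) = Σ≤-* (state π) _ _
      pull (no _)  = Σ≤-0 (state π)

    -- One generation of the tree: the word, its fixed-point child and its two-cycle children. If
    -- all points are light this is `light-kernel`; otherwise the fixed-point child is not good and
    -- `heavy-kernel` applies.
    weight-kernel : ∀ {n} (π : Word n) → Involutive π → m < n →
      weight π ≈ when (good? π) (p ^ fix π) + x * weight (addFixed π)
                 + y * Σᴸ (λ v → weight (addSwap v π)) (allFin (suc n))
    weight-kernel {n} π inv m<n = trans (split (state π ℕ.≟ n)) (+-congˡ (*-congˡ (sym (Σ-addSwap π inv (ℕ.<⇒≤ m<n)))))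
      where
      q = p ^ fix π
      s = state π
      Goal : Set _
      Goal = weight π ≈ when (good? π) q + x * weight (addFixed π)
                          + y * when (good? π) (q * Σ≤ s (branch (lightSwap n s)))
      split : Dec (s ≡ n) → Goal
      split (yes s≡n) = begin
        weight π
          ≈⟨ when-yes (good? π) (good-light s≡n) ⟩
        q * descendants n s
          ≈⟨ *-congˡ (reflexive (descendants-all s≡n)) ⟩
        q * (κ * lam ^ d)
          ≈⟨ *-congˡ (light-kernel d) ⟩
        q * (𝟏 + x * (p * (μ * lam ^ suc d)) + y * Σ≤ (suc d ℕ.+ m) (branch (κ * lam ^ suc (suc d))))
          ≈⟨ solve 6 (λ q x p z y t → q :* (con ℚ.1ℚ :+ x :* (p :* z) :+ y :* t) :=
               q :+ x :* (p :* q :* z) :+ y :* (q :* t)) refl q x p _ y _ ⟩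
        q + x * (p * q * (μ * lam ^ suc d)) + y * (q * Σ≤ (suc d ℕ.+ m) (branch (κ * lam ^ suc (suc d))))
          ≈⟨ +-cong (+-cong (when-yes (good? π) (good-light s≡n)) (*-congˡ fixed))
               (*-congˡ (trans (when-yes (good? π) (good-light s≡n)) (*-congˡ swaps))) ⟨
        when (good? π) q + x * weight (addFixed π) + y * when (good? π) (q * Σ≤ s (branch (lightSwap n s))) ∎
        where
        d = n ∸ suc m
        n≡ : n ≡ suc d ℕ.+ m
        n≡ = ≡.sym (≡.trans (≡.sym (ℕ.+-suc d m)) (ℕ.m∸n+n≡m m<n))
        n∸m : n ∸ m ≡ suc d
        n∸m = ≡.trans (≡.cong (_∸ m) n≡) (ℕ.m+n∸n≡m (suc d) m)
        fixed : weight (addFixed π) ≈ p * q * (μ * lam ^ suc d)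
        fixed = trans (when-yes (good? (addFixed π)) (addFixed-good⁺ π s≡n)) (*-cong
          (reflexive (≡.cong (p ^_) (fix-addFixed π)))
          (reflexive (≡.trans (≡.cong (descendants (suc n)) (state-addFixed π m<n s≡n))
            (≡.trans (descendants-heavy (ℕ.n<1+n n)) (≡.cong (λ e → μ * lam ^ e) n∸m)))))
        lightSwap≡ : lightSwap n s ≡ κ * lam ^ suc (suc d)
        lightSwap≡ with s ℕ.≟ n
        ... | yes _  = ≡.cong (λ e → κ * lam ^ suc e) n∸m
        ... | no neq = contradiction s≡n neq
        swaps : Σ≤ s (branch (lightSwap n s)) ≈ Σ≤ (suc d ℕ.+ m) (branch (κ * lam ^ suc (suc d)))
        swaps = reflexive (≡.cong₂ (λ i b → Σ≤ i (branch b)) (≡.trans s≡n n≡) lightSwap≡)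
      split (no s≢n) = begin
        weight π
          ≈⟨ distribute (good? π) ⟩
        when (good? π) q + y * when (good? π) (q * Σ≤ s (branch (lightSwap n s)))
          ≈⟨ +-congʳ (trans (+-congˡ (trans (*-congˡ
               (when-no (good? (addFixed π)) λ good → s≢n (addFixed-good⁻ π good))) (zeroʳ x))) (+-identityʳ _)) ⟨
        when (good? π) q + x * weight (addFixed π) + y * when (good? π) (q * Σ≤ s (branch (lightSwap n s))) ∎
        where
        s<n : s < n
        s<n = ℕ.≤∧≢⇒< (bound (state-correct π)) s≢n
        m≤s : m ≤ s
        m≤s = state-≥ π (ℕ.<⇒≤ m<n) (ℕ.n≤1+n m)
        d = s ∸ m
        lightSwap≡ : lightSwap n s ≡ μ * lam ^ suc d
        lightSwap≡ with s ℕ.≟ n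
        ... | yes eq = contradiction eq s≢n
        ... | no _   = ≡.cong (λ e → μ * lam ^ e) (ℕ.+-∸-assoc 1 m≤s)
        kernel : descendants n s ≈ 𝟏 + y * Σ≤ s (branch (lightSwap n s))
        kernel = trans (reflexive (descendants-heavy s<n)) (trans (heavy-kernel d)
          (+-congˡ (*-congˡ (reflexive (≡.cong₂ (λ i b → Σ≤ i (branch b)) (ℕ.m∸n+n≡m m≤s) (≡.sym lightSwap≡))))))
        distribute : (P? : Dec (Good π)) → when P? (q * descendants n s) ≈
          when P? q + y * when P? (q * Σ≤ s (branch (lightSwap n s)))
        distribute (yes _) = trans (*-congˡ kernel)
          (solve 3 (λ q y t → q :* (con ℚ.1ℚ :+ y :* t) := q :+ y :* (q :* t)) refl q y _)
        distribute (no _) = sym (trans (+-identityˡ _) (zeroʳ y))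

    S F W : ℕ → Carrier
    S n = Σᴸ weight (involutions n)
    F n = Σᴸ (λ π → weight (addFixed π)) (involutions n)
    W n = Σᴸ weight (cartesianProductWith addSwap (allFin (suc n)) (involutions n))

    S-split : ∀ n → S (suc (suc n)) ≈ F (suc n) + W n
    S-split n = trans (Σᴸ-++ weight (map addFixed (involutions (suc n))) _)
                      (+-congʳ (Σᴸ-map weight addFixed (involutions (suc n))))

    S-kernel : ∀ {n} → m < n → S n ≈ avoidingGF n + x * F n + y * W n
    S-kernel {n} m<n = begin
      Σᴸ weight I
        ≈⟨ Σᴸ-cong (λ {π} inv → weight-kernel π inv m<n) (involutions-involutive n) ⟩
      Σᴸ (λ π → when (good? π) (p ^ fix π) + x * weight (addFixed π)
                + y * Σᴸ (λ v → weight (addSwap v π)) (allFin (suc n))) I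
        ≈⟨ trans (Σᴸ-+ _ _ I) (+-congʳ (Σᴸ-+ _ _ I)) ⟩
      Σᴸ (λ π → when (good? π) (p ^ fix π)) I + Σᴸ (λ π → x * weight (addFixed π)) I
        + Σᴸ (λ π → y * Σᴸ (λ v → weight (addSwap v π)) (allFin (suc n))) I
        ≈⟨ +-cong (+-cong (sym (avoidingGF-good n)) (Σᴸ-* x _ I))
             (trans (Σᴸ-* y _ I) (*-congˡ (sym (Σᴸ-cartesianProductWith weight addSwap (allFin (suc n)) I)))) ⟩
      avoidingGF n + x * F n + y * W n ∎
      where I = involutions n

    -- Stands for ∑ xʲ `avoidingGF` (n + 1 + j): a good word with more than `n` letters has an
    -- ancestor of length n + 1, or its line of ancestors jumps from length n to n + 2 by a
    -- two-cycle.
    tailGF : ℕ → Carrier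
    tailGF n = S (suc n) + x * W n

    -- Opening the roots of length n + 1 releases their fixed-point children `F (suc n)`; together
    -- with `W n` they are all roots of length n + 2.
    tailGF-step : ∀ n → m ≤ n → tailGF n ≈ avoidingGF (suc n) + x * tailGF (suc n)
    tailGF-step n m≤n = begin
      S (suc n) + x * W n
        ≈⟨ +-congʳ (S-kernel (s≤s m≤n)) ⟩
      avoidingGF (suc n) + x * F (suc n) + y * W (suc n) + x * W n
        ≈⟨ solve 5 (λ t x f w′ w → t :+ x :* f :+ x :* x :* w′ :+ x :* w := t :+ x :* ((f :+ w) :+ x :* w′)) refl
             (avoidingGF (suc n)) x (F (suc n)) (W (suc n)) (W n) ⟩
      avoidingGF (suc n) + x * ((F (suc n) + W n) + x * W (suc n))
        ≈⟨ +-congˡ (*-congˡ (+-congʳ (S-split n))) ⟨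
      avoidingGF (suc n) + x * tailGF (suc n) ∎

    S-start : S (suc m) ≈ κ * involutionGF (suc m)
    S-start = begin
      Σᴸ weight I
        ≈⟨ Σᴸ-cong (λ {π} _ → trans (when-yes (good? π) (good-short π ℕ.≤-refl))
             (trans (*-congˡ (initial (state-short π ℕ.≤-refl))) (*-comm _ κ))) (involutions-involutive (suc m)) ⟩
      Σᴸ (λ π → κ * p ^ fix π) I
        ≈⟨ Σᴸ-* κ _ I ⟩
      κ * Σᴸ (λ π → p ^ fix π) I
        ≈⟨ *-congˡ (involutionGF-involutions (suc m)) ⟨
      κ * involutionGF (suc m) ∎
      where
      I = involutions (suc m)
      initial : ∀ {s} → s ≡ suc m → descendants (suc m) s ≈ κ
      initial eq = trans (reflexive (≡.trans (descendants-all eq) (≡.cong (λ e → κ * lam ^ e) (ℕ.n∸n≡0 m)))) (*-identityʳ κ)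

    -- No `t` exceeds `m` here, so each of the `c` two-cycles is light and leads to an all-light
    -- word with m + 2 letters, whose subtree is κ lam.
    W-start : W m ≈ c * (lam * κ) * involutionGF m
    W-start = begin
      Σᴸ weight (cartesianProductWith addSwap (allFin (suc m)) I)
        ≈⟨ Σᴸ-cartesianProductWith weight addSwap (allFin (suc m)) I ⟩
      Σᴸ (λ π → Σᴸ (λ v → weight (addSwap v π)) (allFin (suc m))) I
        ≈⟨ Σᴸ-cong (λ {π} inv → trans (Σ-addSwap π inv ℕ.≤-refl)
             (trans (when-yes (good? π) (good-short π (ℕ.n≤1+n m)))
             (trans (*-congˡ (initial (state-short π (ℕ.n≤1+n m)))) (*-comm _ _)))) (involutions-involutive m) ⟩
      Σᴸ (λ π → c * (lam * κ) * p ^ fix π) I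
        ≈⟨ Σᴸ-* _ _ I ⟩
      c * (lam * κ) * Σᴸ (λ π → p ^ fix π) I
        ≈⟨ *-congˡ (involutionGF-involutions m) ⟨
      c * (lam * κ) * involutionGF m ∎
      where
      I = involutions m
      lightSwap≡ : lightSwap m m ≡ κ * lam ^ suc (m ∸ m)
      lightSwap≡ with m ℕ.≟ m
      ... | yes _  = ≡.refl
      ... | no neq = contradiction ≡.refl neq
      initial : ∀ {s} → s ≡ m → Σ≤ s (branch (lightSwap m s)) ≈ c * (lam * κ)
      initial ≡.refl = trans (Σ≤-branch₀ _) (*-congˡ (trans
        (reflexive (≡.trans lightSwap≡ (≡.cong (λ e → κ * lam ^ suc e) (ℕ.n∸n≡0 m))))
        (trans (*-congˡ (*-identityʳ lam)) (*-comm κ lam))))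

    tailGF-start : tailGF m ≈ κ * involutionGF (suc m) + x * (c * (lam * κ) * involutionGF m)
    tailGF-start = +-cong S-start (*-congˡ W-start)

-- From ring identities to equality of Laurent series

module Models (R : CommutativeRing 0ℓ 0ℓ) (φ : RationalAlgebra R) (X p : CommutativeRing.Carrier R) where
  open import Defs using (x^_; scalar)
  open CommutativeRing R
  open _-Raw-AlmostCommutative⟶_ φ using (⟦_⟧)
  open ListSums R using (Σᴸ)
  open import Algebra.Properties.CommutativeMonoid.Sum +-commutativeMonoid using (sum)
  open import Algebra.Properties.Semiring.Exp semiring using (_^_)

  -- Rep d f r says that the Laurent series f is written with pole order d and that xᵈ f = r.
  record LaurentModel : Set (lsuc 0ℓ) where
    field
      Rep : ℕ → Laurent → Carrier → Set
      power : ℕ → Carrier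
      power-zero : power 0 ≈ 1#
      power-suc : ∀ j → power (suc j) ≈ X * power j
      rep-resp : ∀ {d f r t} → r ≈ t → Rep d f r → Rep d f t
      rep-* : ∀ {d e f g r t} → Rep d f r → Rep e g t → Rep (d ℕ.+ e) (f Defs.* g) (r * t)
      rep-+ : ∀ {f g r t} → Rep 0 f r → Rep 0 g t → Rep 0 (f Defs.+ g) (r + t)
      rep-+₁ : ∀ {f g r t} → Rep 0 f r → Rep 1 g t → Rep 1 (f Defs.+ g) (X * r + t)
      rep-neg : ∀ {d f r} → Rep d f r → Rep d (Defs.- f) (- r)
      rep-sum : ∀ {q} {f : Fin q → Laurent} {r : Fin q → Carrier} →
        (∀ j → Rep 0 (f j) (r j)) → Rep 0 (Defs.sum f) (sum r)
      rep-scalar : ∀ q → Rep 0 (scalar q) ⟦ q ⟧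
      rep-p : Rep 0 Defs.p p
      rep-x^ : ∀ j → Rep 0 (x^ (+ j)) (power j)
      rep-x⁻¹ : Rep 1 (x^ -[1+ 0 ]) 1#
      rep-fixSum : ∀ {n} (πs : List (Word n)) → Rep 0 (𝕃.constant (fixSum πs)) (Σᴸ (λ π → p ^ fix π) πs)
      rep-series : ∀ (a : ℕ → ℚ[p].Poly) (r f : ℕ → Carrier) q → (∀ n → Rep 0 (𝕃.constant (a n)) (r n)) →
        (∀ n → f n ≈ r (n ℕ.+ q) + X * f (suc n)) →
        Rep 0 (𝕃.fromSeries a) (sum {q} (λ j → r (toℕ j) * power (toℕ j)) + power q * f 0)
      rep-≈ : ∀ {f g r} → Rep 0 f r → Rep 0 g r → f Defs.≈ g
      rep-≈₁ : ∀ {f g r} → Rep 0 f r → Rep 1 g (X * r) → f Defs.≈ g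

module Equation (m : ℕ) {k : ℕ} (T : List (Word k))
  (avoids⇔good : ∀ {n} (π : Word n) → Insertion.Involutive π → Avoids T π ⇔ States.Good m π)
  (R : CommutativeRing 0ℓ 0ℓ) (φ : RationalAlgebra R)
  (X p u μ c⁻¹ : CommutativeRing.Carrier R) (model : Models.LaurentModel R φ X p)
  (rep-u₀ : Models.LaurentModel.Rep model 0 (Defs.u₀ (suc (suc (suc m)))) u)
  (roots : Kernel.Params.Roots R φ m X p u μ c⁻¹) where
  open import Defs using (J; x^_; scalar; int; u₀)
  import Data.Nat.Properties as ℕ
  import Data.Fin.Properties as Fin
  open CommutativeRing R
  open Models.LaurentModel model
  open Integers R φ using (nat-rational)
  open RationalSolver R φ using (solve; _:+_; _:*_; _:-_; _:=_; con)
  open Kernel R φ using (½; 𝟐; nat)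
  open Kernel.Params R φ m X p u μ c⁻¹ using (M; y; c; lam; κ; module Equations)
  open Equations roots using (closed-form)
  open Tree R φ m T avoids⇔good X p u μ c⁻¹
  open import Relation.Binary.Reasoning.Setoid setoid
  open import Algebra.Properties.CommutativeMonoid.Sum +-commutativeMonoid using (sum; sum-cong-≋)

  J-sum J₁ J₀ Z₁ Z₀ rest : Carrier
  J-sum = sum {suc m} λ j → involutionGF (toℕ j) * power (toℕ j)
  J₁ = involutionGF (suc m)
  J₀ = involutionGF m
  Z₁ = p + (p * M * y - 𝟐 * X - p) * u
  Z₀ = X + p - (X * y * M - p * y * (M + 𝟐) + X + p) * u
  rest = κ * J₁ + X * (c * (lam * κ) * J₀)

  J-sumᴸ Z₁ᴸ Z₀ᴸ : Laurent
  J-sumᴸ = Defs.sum (λ (j : Fin (suc m)) → J (toℕ j) Defs.* x^ (+ toℕ j))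
  Z₁ᴸ = Defs.p Defs.+ (Defs.p Defs.* int (+ m) Defs.* x^ (+ 2) Defs.- int (+ 2) Defs.* Defs.x Defs.- Defs.p)
        Defs.* u₀ (suc (suc (suc m)))
  Z₀ᴸ = Defs.x Defs.+ Defs.p Defs.- (x^ (+ 3) Defs.* int (+ m) Defs.- Defs.p Defs.* x^ (+ 2) Defs.* int (+ suc (suc m))
        Defs.+ Defs.x Defs.+ Defs.p) Defs.* u₀ (suc (suc (suc m)))

  -- Up to degree m every involution is good, which gives the initial `J` sum; the remaining
  -- coefficients are telescoped into `tailGF` at `m`.
  rep-involutionSeries : Rep 0 (involutionSeries T) (J-sum + power (suc m) * rest)
  rep-involutionSeries = rep-resp
    (+-cong (sum-cong-≋ {suc m} λ j → *-congʳ {power (toℕ j)} (avoidingGF-short (toℕ j) (ℕ.<⇒≤ (Fin.toℕ<n j))))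
            (*-congˡ (tailGF-start roots)))
    (rep-series _ avoidingGF (λ n → tailGF roots (n ℕ.+ m)) (suc m) (λ n → rep-fixSum (Defs.ℐ-avoiding T n))
      λ n → trans (tailGF-step roots (n ℕ.+ m) (ℕ.m≤n+m m n))
        (+-congʳ (reflexive (≡.cong avoidingGF (≡.sym (ℕ.+-suc n m))))))

  rep-J-sum : Rep 0 J-sumᴸ J-sum
  rep-J-sum = rep-sum {suc m} {r = λ j → involutionGF (toℕ j) * power (toℕ j)} λ j → rep-* (rep-fixSum (Defs.ℐ (toℕ j))) (rep-x^ (toℕ j))

  rep-J₁ : Rep 0 (J (suc m)) J₁
  rep-J₁ = rep-fixSum (Defs.ℐ (suc m))

  rep-J₀ : Rep 0 (J m) J₀
  rep-J₀ = rep-fixSum (Defs.ℐ m)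

  rep-- : ∀ {f g r t} → Rep 0 f r → Rep 0 g t → Rep 0 (f Defs.- g) (r - t)
  rep-- f g = rep-+ f (rep-neg g)

  rep-int : ∀ n → Rep 0 (int (+ n)) (nat n)
  rep-int n = rep-resp (sym (nat-rational n)) (rep-scalar (+ n ℚ./ 1))

  power-one : power 1 ≈ X
  power-one = trans (power-suc 0) (trans (*-congˡ power-zero) (*-identityʳ X))

  power-two : power 2 ≈ y
  power-two = trans (power-suc 1) (*-congˡ power-one)

  rep-x : Rep 0 Defs.x X
  rep-x = rep-resp power-one (rep-x^ 1)

  rep-x² : Rep 0 (x^ (+ 2)) y
  rep-x² = rep-resp power-two (rep-x^ 2)

  rep-x³ : Rep 0 (x^ (+ 3)) (X * y)
  rep-x³ = rep-resp (trans (power-suc 2) (*-congˡ power-two)) (rep-x^ 3)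

  rep-Z₁ : Rep 0 Z₁ᴸ Z₁
  rep-Z₁ = rep-+ rep-p (rep-* (rep-- (rep-- (rep-* (rep-* rep-p (rep-int m)) rep-x²)
    (rep-* (rep-scalar (+ 2 ℚ./ 1)) rep-x)) rep-p) rep-u₀)

  rep-Z₀ : Rep 0 Z₀ᴸ Z₀
  rep-Z₀ = rep-- (rep-+ rep-x rep-p) (rep-* (rep-+ (rep-+ (rep-- (rep-* rep-x³ (rep-int m))
    (rep-* (rep-* rep-p rep-x²) (rep-resp M+2 (rep-int (suc (suc m)))))) rep-x) rep-p) rep-u₀)
    where
    M+2 : nat (suc (suc m)) ≈ M + 𝟐
    M+2 = solve 1 (λ m → con ℚ.1ℚ :+ (con ℚ.1ℚ :+ m) := m :+ con (ℚ.1ℚ ℚ.+ ℚ.1ℚ)) refl M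

  equation-suc : ∀ q → m ≡ suc q → involutionSeries T Defs.≈
    J-sumᴸ Defs.- scalar ℚ.½ Defs.* x^ (+ m) Defs.* Z₁ᴸ Defs.* J (suc m)
           Defs.- scalar ℚ.½ Defs.* x^ (+ q) Defs.* Z₀ᴸ Defs.* J m
  equation-suc q m≡ = rep-≈
    (rep-resp (begin
      J-sum + power (suc m) * rest                  ≈⟨ +-congˡ (*-congʳ (trans (power-suc m) (*-congˡ x^m))) ⟩
      J-sum + X * (X * power q) * rest              ≈⟨ closed-form J-sum (power q) J₁ J₀ ⟩
      J-sum - ½ * (X * power q) * Z₁ * J₁ - ½ * power q * Z₀ * J₀ ∎) rep-involutionSeries)
    (rep-- (rep-- rep-J-sum (rep-* (rep-* (rep-* (rep-scalar ℚ.½) (rep-resp x^m (rep-x^ m))) rep-Z₁) rep-J₁))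
      (rep-* (rep-* (rep-* (rep-scalar ℚ.½) (rep-x^ q)) rep-Z₀) rep-J₀))
    where
    x^m : power m ≈ X * power q
    x^m = trans (reflexive (≡.cong power m≡)) (power-suc q)

  -- The factor x⁻¹ gives the right side a representation with pole order one, so the closed form is
  -- established for X times both sides.
  equation-zero : m ≡ 0 → involutionSeries T Defs.≈
    J-sumᴸ Defs.- scalar ℚ.½ Defs.* x^ (+ m) Defs.* Z₁ᴸ Defs.* J (suc m)
           Defs.- scalar ℚ.½ Defs.* x^ -[1+ 0 ] Defs.* Z₀ᴸ Defs.* J m
  equation-zero m≡ = rep-≈₁ rep-involutionSeries (rep-resp (sym (begin
        X * (J-sum + power (suc m) * rest)
      ≈⟨ *-congˡ (+-congˡ (*-congʳ (trans (power-suc m) (*-congˡ x^m)))) ⟩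
    X * (J-sum + X * 1# * rest)
      ≈⟨ solve 4 (λ x s o t → x :* (s :+ x :* o :* t) := x :* s :+ x :* (x :* o) :* t) refl X J-sum 1# rest ⟩
    X * J-sum + X * (X * 1#) * rest
      ≈⟨ closed-form (X * J-sum) 1# J₁ J₀ ⟩
    X * J-sum - ½ * (X * 1#) * Z₁ * J₁ - ½ * 1# * Z₀ * J₀
      ≈⟨ +-congʳ (solve 6 (λ x s h o z j → x :* s :- h :* (x :* o) :* z :* j := x :* (s :- h :* o :* z :* j)) refl
           X J-sum ½ 1# Z₁ J₁) ⟩
    X * (J-sum - ½ * 1# * Z₁ * J₁) - ½ * 1# * Z₀ * J₀ ∎))
    (rep-+₁ (rep-- rep-J-sum (rep-* (rep-* (rep-* (rep-scalar ℚ.½) (rep-resp x^m (rep-x^ m))) rep-Z₁) rep-J₁))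
      (rep-neg (rep-* (rep-* (rep-* (rep-scalar ℚ.½) rep-x⁻¹) rep-Z₀) rep-J₀))))
    where
    x^m : power m ≈ 1#
    x^m = trans (reflexive (≡.cong power m≡)) power-zero

-- Polynomials in p as series, and the concrete Laurent model

module Coefficients where
  open import Data.Nat using (zero; suc)
  open import Data.List using (List; []; _∷_; map)
  open import Relation.Binary.PropositionalEquality
  open PowerSeriesRing ℚ.+-*-commutativeRing

  coeff : ℚ[p].Poly → Series
  coeff = ℚ[p].coeff

  coeff-+ : ∀ as bs → coeff (as ℚ[p].+ bs) ≋ coeff as ⊕′ coeff bs
  coeff-+ []       bs       i       = sym (ℚ.+-identityˡ _)
  coeff-+ (a ∷ as) []       i       = sym (ℚ.+-identityʳ _)
  coeff-+ (a ∷ as) (b ∷ bs) zero    = refl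
  coeff-+ (a ∷ as) (b ∷ bs) (suc i) = coeff-+ as bs i

  coeff-scale : ∀ a bs i → coeff (map (a ℚ.*_) bs) i ≡ a ℚ.* coeff bs i
  coeff-scale a []       i       = sym (ℚ.*-zeroʳ a)
  coeff-scale a (b ∷ bs) zero    = refl
  coeff-scale a (b ∷ bs) (suc i) = coeff-scale a bs i

  coeff-neg : ∀ as i → coeff (ℚ[p].- as) i ≡ ℚ.- coeff as i
  coeff-neg []       i       = refl
  coeff-neg (a ∷ as) zero    = refl
  coeff-neg (a ∷ as) (suc i) = coeff-neg as i

  coeff-* : ∀ as bs → coeff (as ℚ[p].* bs) ≋ coeff as ⊛ coeff bs
  coeff-* []       bs i       = sym (zero-⊛ (λ _ → refl) (coeff bs) i)
  coeff-* (a ∷ as) bs zero    = trans (coeff-+ (map (a ℚ.*_) bs) _ zero) (cong (ℚ._+ ℚ.0ℚ) (coeff-scale a bs 0))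
  coeff-* (a ∷ as) bs (suc i) = trans (coeff-+ (map (a ℚ.*_) bs) _ (suc i))
    (cong₂ ℚ._+_ (coeff-scale a bs (suc i)) (coeff-* as bs i))

  coeff-constant : ∀ q → coeff (ℚ[p].constant q) ≋ C q
  coeff-constant q zero    = refl
  coeff-constant q (suc i) = refl

  coeff-indeterminate : coeff ℚ[p].indeterminate ≋ X
  coeff-indeterminate zero          = refl
  coeff-indeterminate (suc zero)    = refl
  coeff-indeterminate (suc (suc i)) = refl

module Representation where
  open import Defs using (x^_; scalar; u₀)
  open import Data.Nat as ℕ using (zero; suc)
  import Data.Nat.Properties as ℕ
  open import Data.Integer using (+_; -[1+_])
  open import Data.Fin using (Fin; toℕ)
  open import Data.List using (List; []; _∷_)
  open import Function using (_∘_)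
  import Relation.Binary.PropositionalEquality as ≡
  open ≡ using (_≡_)
  open 𝕃 using (x⁻_·_)
  open Coefficients
  private module A = PowerSeriesRing ℚ.+-*-commutativeRing
  open Bivariate using (commutativeRing; Series; monomial; shift; X; C; ⊛-cong; shift-⊛; C-cong; C-+; C-*; C-0; φ)
  open CommutativeRing commutativeRing
  open import Algebra.Properties.CommutativeMonoid.Sum +-commutativeMonoid using (sum; sum-cong-≋)
  open import Algebra.Properties.Semiring.Exp semiring using (_^_)

  data Rep (d : ℕ) : Laurent → Series → Set where
    rep : ∀ {s r} → (λ n → coeff (s n)) ≈ r → Rep d (x⁻ d · s) r

  rep-resp : ∀ {d f r r′} → r ≈ r′ → Rep d f r → Rep d f r′
  rep-resp eq (rep {r = r} s≈r) = rep (trans s≈r eq)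

  rep-* : ∀ {d e f g r t} → Rep d f r → Rep e g t → Rep (d ℕ.+ e) (f Defs.* g) (r * t)
  rep-* (rep {s} {r} s≈r) (rep {s′} {t} s′≈t) = rep (trans
    (SeriesMap.map-⊛ ℚ[p].rawRing A.commutativeRing coeff coeff-+ coeff-* (λ _ → ≡.refl) s s′)
    (⊛-cong s≈r s′≈t))

  rep-+ : ∀ {f g r t} → Rep 0 f r → Rep 0 g t → Rep 0 (f Defs.+ g) (r + t)
  rep-+ (rep {s} s≈r) (rep {s′} s′≈t) = rep λ n i → ≡.trans (coeff-+ (s n) (s′ n) i) (≡.cong₂ ℚ._+_ (s≈r n i) (s′≈t n i))

  rep-+₁ : ∀ {f g r t} → Rep 0 f r → Rep 1 g t → Rep 1 (f Defs.+ g) (X * r + t)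
  rep-+₁ (rep {s} {r} s≈r) (rep {s′} {t} s′≈t) = rep λ n i → ≡.trans (coeff-+ (𝕃shift n) (s′ n) i)
    (≡.cong₂ ℚ._+_ (≡.trans (shifted n i) (≡.sym (shift-⊛ 1 r n i))) (s′≈t n i))
    where
    𝕃shift = Defs.PowerSeries.shift ℚ[p].rawRing 1 s
    shifted : ∀ n i → coeff (𝕃shift n) i ≡ shift 1 r n i
    shifted zero    i = ≡.refl
    shifted (suc n) i = s≈r n i

  rep-neg : ∀ {d f r} → Rep d f r → Rep d (Defs.- f) (- r)
  rep-neg (rep {s} s≈r) = rep λ n i → ≡.trans (coeff-neg (s n) i) (≡.cong ℚ.-_ (s≈r n i))

  rep-constant : ∀ {a r} → coeff a A.≋ r → Rep 0 (𝕃.constant a) (C r)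
  rep-constant eq = rep λ { zero i → eq i ; (suc n) i → ≡.refl }

  rep-scalar : ∀ q → Rep 0 (scalar q) (C (A.C q))
  rep-scalar q = rep-constant (coeff-constant q)

  rep-p : Rep 0 Defs.p (C A.X)
  rep-p = rep-constant coeff-indeterminate

  coeff-monomial : ∀ j → (λ n → coeff (Defs.PowerSeries.monomial ℚ[p].rawRing j ℚ[p].1# n)) ≈ monomial j (A.C ℚ.1ℚ)
  coeff-monomial zero    zero    = coeff-constant ℚ.1ℚ
  coeff-monomial zero    (suc n) = λ _ → ≡.refl
  coeff-monomial (suc j) zero    = λ _ → ≡.refl
  coeff-monomial (suc j) (suc n) = coeff-monomial j n

  rep-x^ : ∀ j → Rep 0 (x^ (+ j)) (monomial j (A.C ℚ.1ℚ))
  rep-x^ j = rep (coeff-monomial j)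

  rep-x⁻¹ : Rep 1 (x^ -[1+ 0 ]) 1#
  rep-x⁻¹ = rep (coeff-monomial 0)

  rep-sum : ∀ {q} {f : Fin q → Laurent} {r : Fin q → Series} → (∀ j → Rep 0 (f j) (r j)) → Rep 0 (Defs.sum f) (sum r)
  rep-sum {zero}  reps = rep-resp C-0 (rep-constant {[]} λ _ → ≡.refl)
  rep-sum {suc q} reps = rep-+ (reps Fin.zero) (rep-sum (reps ∘ Fin.suc))

  rep-u₀ : ∀ k → Rep 0 (u₀ k) (Bivariate.E (Defs.1/√ Defs.discriminant k))
  rep-u₀ k = rep λ n → coeff-constant ((Defs.1/√ Defs.discriminant k) n)

  rep-≈ : ∀ {f g r} → Rep 0 f r → Rep 0 g r → f Defs.≈ g
  rep-≈ (rep s≈r) (rep s′≈r) (+ n)    i = ≡.trans (s≈r (n ℕ.+ 0) i) (≡.sym (s′≈r (n ℕ.+ 0) i))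
  rep-≈ (rep s≈r) (rep s′≈r) -[1+ n ] i = ≡.refl

  rep-≈₁ : ∀ {f g r} → Rep 0 f r → Rep 1 g (X * r) → f Defs.≈ g
  rep-≈₁ {r = r} (rep {s} s≈r) (rep {s′} s′≈xr) = λ
    { (+ n) i → ≡.trans (≡.cong (λ j → coeff (s j) i) (ℕ.+-identityʳ n)) (≡.trans (s≈r n i)
        (≡.trans (≡.sym (shift-⊛ 1 r (suc n) i)) (≡.trans (≡.sym (s′≈xr (suc n) i))
        (≡.cong (λ j → coeff (s′ j) i) (ℕ.+-comm 1 n)))))
    -- The coefficient of x⁻¹: zero by default on the left, the vanishing constant term of `X * r`
    -- on the right.
    ; -[1+ zero ]  i → ≡.sym (≡.trans (s′≈xr 0 i) (shift-⊛ 1 r 0 i))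
    ; -[1+ suc n ] i → ≡.refl
    }

  coeff-power : ∀ n → C (coeff (ℚ[p].indeterminate ℚ[p].^ n)) ≈ C A.X ^ n
  coeff-power zero    = C-cong (coeff-constant ℚ.1ℚ)
  coeff-power (suc n) = trans (C-cong (coeff-* ℚ[p].indeterminate (ℚ[p].indeterminate ℚ[p].^ n)))
    (trans (C-* (coeff ℚ[p].indeterminate) (coeff (ℚ[p].indeterminate ℚ[p].^ n)))
      (*-cong (C-cong coeff-indeterminate) (coeff-power n)))

  coeff-fixSum : ∀ {n} (πs : List (Word n)) →
    C (coeff (fixSum πs)) ≈ ListSums.Σᴸ commutativeRing (λ π → C A.X ^ Defs.fix π) πs
  coeff-fixSum []       = λ { zero i → ≡.refl ; (suc n) i → ≡.refl }
  coeff-fixSum (π ∷ πs) = trans (C-cong (coeff-+ (ℚ[p].indeterminate ℚ[p].^ Defs.fix π) (fixSum πs)))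
    (trans (C-+ (coeff (ℚ[p].indeterminate ℚ[p].^ Defs.fix π)) (coeff (fixSum πs)))
      (+-cong (coeff-power (Defs.fix π)) (coeff-fixSum πs)))

  rep-fixSum : ∀ {n} (πs : List (Word n)) →
    Rep 0 (𝕃.constant (fixSum πs)) (ListSums.Σᴸ commutativeRing (λ π → C A.X ^ Defs.fix π) πs)
  rep-fixSum πs = rep-resp (coeff-fixSum πs) (rep-constant λ _ → ≡.refl)

  rep-constant⁻ : ∀ {a r} → Rep 0 (𝕃.constant a) r → C (coeff a) ≈ r
  rep-constant⁻ (rep eq) zero    i = eq 0 i
  rep-constant⁻ (rep eq) (suc n) i = eq (suc n) i

  rep-series : ∀ (a : ℕ → ℚ[p].Poly) (r f : ℕ → Series) q → (∀ n → Rep 0 (𝕃.constant (a n)) (r n)) →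
    (∀ n → f n ≈ r (n ℕ.+ q) + X * f (suc n)) →
    Rep 0 (𝕃.fromSeries a) (sum {q} (λ j → r (toℕ j) * monomial (toℕ j) (A.C ℚ.1ℚ)) + monomial q (A.C ℚ.1ℚ) * f 0)
  rep-series a r f q reps step = rep (begin
    coeffs
      ≈⟨ split-at q coeffs ⟩
    initial q coeffs + monomial q (A.C ℚ.1ℚ) * (λ n → coeffs (q ℕ.+ n))
      ≈⟨ +-cong (sum-cong-≋ {q} λ j → *-congʳ {monomial (toℕ j) (A.C ℚ.1ℚ)} (rep-constant⁻ (reps (toℕ j))))
           (*-congˡ {monomial q (A.C ℚ.1ℚ)} (λ n i → ≡.cong (λ j → coeffs j i) (ℕ.+-comm q n))) ⟩
    sum {q} (λ j → r (toℕ j) * monomial (toℕ j) (A.C ℚ.1ℚ)) + monomial q (A.C ℚ.1ℚ) * (λ n → coeffs (n ℕ.+ q))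
      ≈⟨ +-congˡ {sum {q} (λ j → r (toℕ j) * monomial (toℕ j) (A.C ℚ.1ℚ))} (*-congˡ {monomial q (A.C ℚ.1ℚ)}
           (telescope (λ n → coeffs (n ℕ.+ q)) f λ n →
             trans (step n) (+-congʳ {X * f (suc n)} (sym (rep-constant⁻ (reps (n ℕ.+ q))))))) ⟨
    sum {q} (λ j → r (toℕ j) * monomial (toℕ j) (A.C ℚ.1ℚ)) + monomial q (A.C ℚ.1ℚ) * f 0 ∎)
    where
    open Unfolding A.commutativeRing using (initial; split-at; telescope)
    open import Relation.Binary.Reasoning.Setoid setoid
    coeffs : ℕ → A.Series
    coeffs n = coeff (a n)

laurentModel : Models.LaurentModel Bivariate.commutativeRing Bivariate.φ Bivariate.X Bivariate.p
laurentModel = record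
  { Rep = Rep
  ; power = λ j → Bivariate.monomial j (A.C ℚ.1ℚ)
  ; power-zero = λ _ _ → ≡.refl
  ; power-suc = Unfolding.monomial-suc A.commutativeRing
  ; rep-resp = rep-resp
  ; rep-* = rep-*
  ; rep-+ = rep-+
  ; rep-+₁ = rep-+₁
  ; rep-neg = rep-neg
  ; rep-sum = rep-sum
  ; rep-scalar = rep-scalar
  ; rep-p = rep-p
  ; rep-x^ = rep-x^
  ; rep-x⁻¹ = rep-x⁻¹
  ; rep-fixSum = rep-fixSum
  ; rep-series = rep-series
  ; rep-≈ = rep-≈
  ; rep-≈₁ = rep-≈₁
  }
  where
  open Representation
  import Relation.Binary.PropositionalEquality as ≡
  module A = PowerSeriesRing ℚ.+-*-commutativeRing

-- The identity for each k

open import Defs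
open import Data.Fin using (Fin; toℕ)
open import Data.Integer using (+_; _⊖_)
open import Data.Nat using (ℕ; suc; _∸_; _≤_; s≤s)
open import Data.Rational using (½)

module EquationFor m = Equation m (𝒜 (suc (suc (suc m)))) (Avoidance.avoids⇔good m) Bivariate.commutativeRing Bivariate.φ
  Bivariate.X Bivariate.p (Bivariate.u m) (Bivariate.μ m) (Bivariate.c⁻¹ m) laurentModel
  (Representation.rep-u₀ (suc (suc (suc m)))) (Bivariate.roots m)

theorem1p1 : (k : ℕ) → 3 ≤ k →
    involutionSeries (𝒜 k)
    ≈ sum (λ (j : Fin (suc (k ∸ 3))) → J (toℕ j) * x^ (+ toℕ j))
    - scalar ½ * x^ (k ⊖ 3)
    * (p + (p * int (k ⊖ 3) * x^ (+ 2) - int (+ 2) * x - p) * u₀ k)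
    * J (k ∸ 2)
    - scalar ½ * x^ (k ⊖ 4)
    * (x + p - (x^ (+ 3) * int (k ⊖ 3) - p * x^ (+ 2) * int (k ⊖ 1) + x + p) * u₀ k)
    * J (k ∸ 3)
theorem1p1 1 (s≤s ())
theorem1p1 2 (s≤s (s≤s ()))
-- The only case with a negative exponent, `k ⊖ 4` being -1.
theorem1p1 3 _ = equation-zero ≡.refl
  where open EquationFor 0
theorem1p1 (suc (suc (suc (suc q)))) _ = equation-suc q ≡.refl
  where open EquationFor (suc q)
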